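{- Let $W$ be a Coxeter group, $y,w \in W$ with $y < w$ in Bruhat order, and fix a reduced expression $\mathsf{w} = \mathsf{w}_1\cdots\mathsf{w}_p$ for $w$. Consider the matching $\mathcal{M}$ of the Hasse diagram of $[y,w]$ consisting of the pairs $\{\mathsf{w}^{\Xi(\sigma)}, \mathsf{w}^{\Xi(\varphi(\sigma))}\}$, where $\sigma$ ranges over the relative masks on $\mathsf{w}$ associated to pairs $(y,x)$ with $y \le x \le w$. Then $\mathcal{M}$ is acyclic: orient the Hasse diagram of $[y,w]$ with an edge $u \to v$ whenever $u$ covers $v$, and then reverse the direction of every edge belonging to $\mathcal{M}$; the resulting directed graph has no directed cycles.
   Context: $W$ is a Coxeter group with generating set $S$, $l$ is the length function, and $\leq$ is the (strong) Bruhat order: $u \leq v$ iff some reduced expression for $u$ is a (not necessarily consecutive) subword of some reduced expression for $v$. Masks. A mask on $\mathsf{w}$ is a vector $\sigma = (\sigma_1, \ldots, \sigma_p) \in \{0,1\}^p$. For $0 \leq j \leq p$ write $\mathsf{w}^{\sigma[j]}$ for the element $\prod_{i \leq j,\ \sigma_i = 1} \mathsf{w}_i$ (product in increasing order of $i$; empty product $=1$), and $\mathsf{w}^\sigma = \mathsf{w}^{\sigma[p]}$. A position $j$ is a defect of $\sigma$ if $\mathsf{w}^{\sigma[j-1]} \mathsf{w}_j < \mathsf{w}^{\sigma[j-1]}$. A mask with no defects is called a constant mask on $\mathsf{w}$ for the element $\mathsf{w}^\sigma$. The same definitions apply to any reduced expression in place of $\mathsf{w}$. It is known (Deodhar) that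 for any reduced expression $\mathsf{v}$ of $v$ and any $u \leq v$ there is a unique constant mask on $\mathsf{v}$ for $u$; moreover if $\tau$ is a constant mask on $\mathsf{w}$ then the subword of $\mathsf{w}$ formed by the letters $\mathsf{w}_i$ with $\tau_i = 1$ (denoted $\mathsf{w}^\tau$, indexed by those positions $i$) is a reduced expression for the element $\mathsf{w}^\tau$; similarly $\mathsf{w}^{\tau[j]}$ denotes the reduced subword consisting of the $\mathsf{w}_i$ with $i \leq j$, $\tau_i = 1$. Relative masks. Given $y \leq x \leq w$, let $\tau$ be the unique constant mask on $\mathsf{w}$ for $x$ and $\nu$ the unique constant mask on the reduced expression $\mathsf{w}^\tau$ for $y$ (its entries indexed by the positions $i$ with $\tau_i = 1$). The relative mask $\sigma \in \{0,1,X\}^p$ associated to $(y,x)$ is $\sigma_j = X$ if $\tau_j = 0$ and $\sigma_j = \nu_j$ if $\tau_j = 1$. The mask $\tau$ is called the $X$-mask of $\sigma$, written $\Xi(\sigma)$; thus $\mathsf{w}^{\Xi(\sigma)} = x$. For $0\le j\le p$ put $\mathsf{w}^{\sigma[j]} = \prod_{i \leq j,\ \sigma_i = 1} \mathsf{w}_i$ and $\mathsf{w}^{\tau[j]} = \prod_{i \le j,\ \tau_i = 1}\mathsf{w}_i$. A position $j$ is a defect of $\sigma$ if $\mathsf{w}^{\sigma[j-1]} \mathsf{w}_j < \mathsf{w}^{\sigma[j-1]}$. A position $j$ is a shifted descent of $\sigma$ if $\mathsf{w}^{\tau[j-1]} \geq \mathsf{w}^{\sigma[j]}$. The map $\varphi$.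 Given a relative mask $\sigma$ with $X$-mask $\tau$, let $j$ be the rightmost position satisfying one of the following, and define $\varphi(\sigma)$ accordingly (all entries not mentioned are unchanged): (1) $\sigma_j = X$ and $j$ is not a defect: change $\sigma_j$ to $0$. (2) $\sigma_j = 0$: change $\sigma_j$ to $X$. (3) $\sigma_j = X$ and $j$ is a defect (then $\mathsf{w}^{\tau[j-1]} \geq \mathsf{w}^{\sigma[j-1]}\mathsf{w}_j$): let $\rho$ be the unique constant mask on the reduced expression $\mathsf{w}^{\tau[j-1]}$ for the element $\mathsf{w}^{\sigma[j-1]}\mathsf{w}_j$; replace $\sigma_i$ by $\rho_i$ for every $i < j$ with $\tau_i = 1$, and set $\sigma_j = 1$. (4) $\sigma_j = 1$ and $j$ is a shifted descent: let $\rho$ be the unique constant mask on $\mathsf{w}^{\tau[j-1]}$ for the element $\mathsf{w}^{\sigma[j]}$; replace $\sigma_i$ by $\rho_i$ for every $i<j$ with $\tau_i = 1$, and set $\sigma_j = X$. (It is a result of the paper that for $y<w$ these pairs form a complete matching of the Hasse diagram of $[y,w]$.) -}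

module Defs where

open import Data.Nat using (ℕ; _≤_; _<_)
open import Data.Maybe using (Maybe; just; nothing)
open import Data.Bool using (Bool; true; false)
open import Data.List using (List; []; _∷_; _++_; length; concat; replicate)
open import Data.List.Relation.Binary.Sublist.Propositional using (_⊆_)
open import Data.Product using (Σ; ∃; ∃-syntax; _×_; _,_)
open import Data.Sum using (_⊎_)
open import Data.Unit using (⊤)
open import Relation.Nullary using (¬_)
open import Relation.Binary.PropositionalEquality using (_≡_; _≢_)
open import Relation.Binary.Construct.Closure.Transitive using (TransClosure)

-- Coxeter systems, given by a Coxeter matrix.  m s t = nothing means ∞.

record CoxeterMatrix : Set₁ where
  field
    S      : Set
    m      : S → S → Maybe ℕ
    m-diag : ∀ s → m s s ≡ just 1
    m-sym  : ∀ s t → m s t ≡ m t s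
    m-off  : ∀ s t → s ≢ t → ∀ k → m s t ≡ just k → 2 ≤ k

module Coxeter (M : CoxeterMatrix) where
  open CoxeterMatrix M

  Word : Set
  Word = List S

  -- The group W = ⟨ S | (st)^{m(s,t)} = 1 ⟩ : elements are words up to
  -- the congruence ≈ generated by the Coxeter relations (a setoid).
  -- (Since s² = 1, the monoid presentation equals the group presentation;
  --  products are concatenation.)
  infix 4 _≈_
  data _≈_ : Word → Word → Set where
    rel   : ∀ s t k → m s t ≡ just k → ∀ u v →
            (u ++ concat (replicate k (s ∷ t ∷ [])) ++ v) ≈ (u ++ v)
    ≈refl  : ∀ {u} → u ≈ u
    ≈sym   : ∀ {u v} → u ≈ v → v ≈ u
    ≈trans : ∀ {u v z} → u ≈ v → v ≈ z → u ≈ z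

  IsReduced : Word → Set
  IsReduced r = ∀ r' → r' ≈ r → length r ≤ length r'

  ReducedExpr : Word → Word → Set
  ReducedExpr r u = IsReduced r × r ≈ u

  infix 4 _≤B_ _<B_ _≥B_
  _≤B_ : Word → Word → Set
  u ≤B v = ∃[ r ] ∃[ r' ] (ReducedExpr r u × ReducedExpr r' v × r ⊆ r')

  _≥B_ : Word → Word → Set
  u ≥B v = v ≤B u

  _<B_ : Word → Word → Set
  u <B v = u ≤B v × ¬ (u ≈ v)

  Covers : Word → Word → Set
  Covers u v = v <B u × (∀ z → v <B z → ¬ (z <B u))

  -- Masks.  Positions j are represented by splittings
  --   w = w₁ ++ s ∷ w₂ ,  mask = μ₁ ++ c ∷ μ₂ ,  length μ₁ = length w₁ ,
  -- so that w₁ is the prefix w_1⋯w_{j-1}, s = w_j.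

  selB : List Bool → Word → Word
  selB (true  ∷ β) (s ∷ w) = s ∷ selB β w
  selB (false ∷ β) (s ∷ w) = selB β w
  selB _ _ = []

  NoDefectB : List Bool → Word → Set
  NoDefectB β w = ∀ w₁ s w₂ β₁ b β₂ → w ≡ w₁ ++ s ∷ w₂ → β ≡ β₁ ++ b ∷ β₂ →
                  length β₁ ≡ length w₁ →
                  ¬ (selB β₁ w₁ ++ s ∷ [] <B selB β₁ w₁)

  ConstMask : Word → List Bool → Word → Set
  ConstMask v β u = length β ≡ length v × NoDefectB β v × selB β v ≈ u

  data Tri : Set where
    𝟎 𝟏 𝐗 : Tri

  Ξ : List Tri → List Bool
  Ξ [] = []
  Ξ (𝐗 ∷ σ) = false ∷ Ξ σ
  Ξ (_ ∷ σ) = true ∷ Ξ σ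

  ν : List Tri → List Bool
  ν [] = []
  ν (𝐗 ∷ σ) = ν σ
  ν (𝟎 ∷ σ) = false ∷ ν σ
  ν (𝟏 ∷ σ) = true ∷ ν σ

  sel1 : List Tri → Word → Word
  sel1 (𝟏 ∷ σ) (s ∷ w) = s ∷ sel1 σ w
  sel1 (_ ∷ σ) (s ∷ w) = sel1 σ w
  sel1 _ _ = []

  selΞ : List Tri → Word → Word
  selΞ σ w = selB (Ξ σ) w

  -- σ is the relative mask on w associated to (y , x) with x = w^{Ξ(σ)},
  -- y ≤ x ≤ w
  RelMask : Word → Word → List Tri → Set
  RelMask y w σ =
    length σ ≡ length w ×
    ConstMask w (Ξ σ) (selΞ σ w) ×
    ConstMask (selΞ σ w) (ν σ) y ×
    y ≤B selΞ σ w × selΞ σ w ≤B w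

  repl : List Tri → List Bool → List Tri
  repl (𝐗 ∷ σ) ρ = 𝐗 ∷ repl σ ρ
  repl (_ ∷ σ) (true  ∷ ρ) = 𝟏 ∷ repl σ ρ
  repl (_ ∷ σ) (false ∷ ρ) = 𝟎 ∷ repl σ ρ
  repl σ _ = σ

  -- with prefix w₁ = w_1⋯w_{j-1}, mask prefix σ₁, letter s = w_j :
  --   w^{σ[j-1]} = sel1 σ₁ w₁ ,  w^{τ[j-1]} = selΞ σ₁ w₁
  IsDefect : Word → List Tri → List S → Set
  IsDefect w₁ σ₁ s = (sel1 σ₁ w₁ ++ s) <B sel1 σ₁ w₁

  Cond : Word → S → List Tri → Tri → Set
  Cond w₁ s σ₁ 𝐗 = ¬ IsDefect w₁ σ₁ (s ∷ []) ⊎ IsDefect w₁ σ₁ (s ∷ [])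
  Cond w₁ s σ₁ 𝟎 = ⊤
  Cond w₁ s σ₁ 𝟏 = selΞ σ₁ w₁ ≥B (sel1 σ₁ w₁ ++ s ∷ [])

  NoCondRightOf : Word → List Tri → ℕ → Set
  NoCondRightOf w σ j = ∀ w₁ s w₂ σ₁ c σ₂ → w ≡ w₁ ++ s ∷ w₂ → σ ≡ σ₁ ++ c ∷ σ₂ →
                        length σ₁ ≡ length w₁ → j < length w₁ → ¬ Cond w₁ s σ₁ c

  -- the map φ, as its graph: Phi w σ σ' means σ' = φ(σ)
  -- (the case is determined by the rightmost position j = length w₁ + 1
  --  satisfying one of (1)–(4))
  data Phi (w : Word) (σ : List Tri) : List Tri → Set where
    case1 : ∀ w₁ s w₂ σ₁ σ₂ → w ≡ w₁ ++ s ∷ w₂ → σ ≡ σ₁ ++ 𝐗 ∷ σ₂ →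
            length σ₁ ≡ length w₁ → NoCondRightOf w σ (length w₁) →
            ¬ IsDefect w₁ σ₁ (s ∷ []) →
            Phi w σ (σ₁ ++ 𝟎 ∷ σ₂)
    case2 : ∀ w₁ s w₂ σ₁ σ₂ → w ≡ w₁ ++ s ∷ w₂ → σ ≡ σ₁ ++ 𝟎 ∷ σ₂ →
            length σ₁ ≡ length w₁ → NoCondRightOf w σ (length w₁) →
            Phi w σ (σ₁ ++ 𝐗 ∷ σ₂)
    case3 : ∀ w₁ s w₂ σ₁ σ₂ → w ≡ w₁ ++ s ∷ w₂ → σ ≡ σ₁ ++ 𝐗 ∷ σ₂ →
            length σ₁ ≡ length w₁ → NoCondRightOf w σ (length w₁) →
            IsDefect w₁ σ₁ (s ∷ []) →
            ∀ ρ → ConstMask (selΞ σ₁ w₁) ρ (sel1 σ₁ w₁ ++ s ∷ []) →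
            Phi w σ (repl σ₁ ρ ++ 𝟏 ∷ σ₂)
    case4 : ∀ w₁ s w₂ σ₁ σ₂ → w ≡ w₁ ++ s ∷ w₂ → σ ≡ σ₁ ++ 𝟏 ∷ σ₂ →
            length σ₁ ≡ length w₁ → NoCondRightOf w σ (length w₁) →
            selΞ σ₁ w₁ ≥B (sel1 σ₁ w₁ ++ s ∷ []) →
            ∀ ρ → ConstMask (selΞ σ₁ w₁) ρ (sel1 σ₁ w₁ ++ s ∷ []) →
            Phi w σ (repl σ₁ ρ ++ 𝐗 ∷ σ₂)

  MPair : Word → Word → Word → Word → Set
  MPair y 𝐰 u v = ∃[ σ ] ∃[ σ' ] (RelMask y 𝐰 σ × Phi 𝐰 σ σ' ×
                                  selΞ σ 𝐰 ≈ u × selΞ σ' 𝐰 ≈ v)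

  Matched : Word → Word → Word → Word → Set
  Matched y 𝐰 u v = MPair y 𝐰 u v ⊎ MPair y 𝐰 v u

  InInterval : Word → Word → Word → Set
  InInterval y w u = y ≤B u × u ≤B w

  Arrow : Word → Word → Word → Word → Word → Set
  Arrow y w 𝐰 u v = InInterval y w u × InInterval y w v ×
                    ((Covers u v × ¬ Matched y 𝐰 u v) ⊎
                     (Covers v u × Matched y 𝐰 u v))

  Path : Word → Word → Word → Word → Word → Set
  Path y w 𝐰 = TransClosure (Arrow y w 𝐰)

{-# OPTIONS --safe #-}

-- On group elements φ reads as follows.  Let s be the last letter of the reduced word of w.  If
-- y ≤ xs then φ(x) = xs; otherwise ys < y, xs < x and φ(x) = φ'(xs)s, where φ' is the matching of
-- [ys, ws].  Let A be the set of x in [y, w] with y ≤ xs, and B its complement.  An arrow leaving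
-- B stays in B: for downward arrows this is the lifting property, and for a matched arrow up to
-- φ(x) it says that inserting the letter toggled by φ creates no shifted descent to its right
-- (NSD-ascent).  On A the only upward arrows are x → xs, and lifting forbids any arrow within A
-- from some x with xs < x to some x' with x's > x', so a cycle in A would only go down.  A cycle
-- in B becomes, after multiplication by s, a cycle for [ys, ws].
--
-- The group has no decidable equality, but the conclusion is a negation, so the argument runs
-- under double negation in continuation-passing style.
module Submission where

open import Defs
open import Data.Bool using (Bool; true; false; not; _xor_)
open import Data.Bool.Properties using (not-involutive; not-¬; xor-same; not-distribˡ-xor) renaming (_≟_ to _≟B_)
open import Data.Empty using (⊥; ⊥-elim)
open import Data.List using (List; []; _∷_; _++_; [_]; _∷ʳ_; length; concat; replicate; reverse; map; applyUpTo)
open import Data.List.Properties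
  using (++-assoc; ++-identityʳ; unfold-reverse; length-++; length-map; reverse-++; reverse-involutive;
         map-++; map-id; map-∘; map-applyUpTo; ∷-injective; ∷ʳ-injective; ∷ʳ-++)
open import Data.List.Relation.Binary.Pointwise as PW using (Pointwise; []; _∷_)
open import Data.List.Relation.Binary.Sublist.Propositional using (_⊆_; []; _∷_; ⊆-refl; ⊆-trans; minimum)
  renaming (_∷ʳ_ to skip)
open import Data.List.Relation.Binary.Sublist.Propositional.Properties using (++⁺; reverse⁺; length-mono-≤)
open import Data.List.Relation.Unary.Any as Any using (Any; here; there)
import Data.List.Relation.Unary.Any.Properties as AnyP
open import Data.List.Reverse using (Reverse; []; _∶_∶ʳ_; reverseView)
open import Data.Nat using (ℕ; zero; suc; pred; _+_; _≤_; _<_; _≤?_; z≤n; s≤s)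
open import Data.Nat.Properties
  using (≤-refl; ≤-trans; ≤-reflexive; ≤-antisym; ≤-pred; <-irrefl; <-cmp; ≮⇒≥; ≰⇒>; n≤1+n; m≤m+n;
         m≤n⇒m<n∨m≡n; +-suc; +-comm; +-cancelˡ-≤; +-cancelʳ-≤; suc-injective)
open import Data.Product using (∃-syntax; _×_; _,_; proj₁; proj₂)
open import Data.Sum as Sum using (_⊎_; inj₁; inj₂)
open import Data.Unit using (⊤; tt)
open import Function using (_∘_)
open import Relation.Binary.Bundles using (Setoid)
open import Relation.Binary.Construct.Closure.Transitive using (TransClosure; _∷_) renaming ([_] to single)
open import Relation.Binary.Definitions using (tri<; tri≈; tri>)
open import Relation.Binary.PropositionalEquality using (_≡_; refl; sym; trans; cong; cong₂; subst; subst₂)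
import Relation.Binary.Reasoning.Setoid as SetoidReasoning
open import Relation.Nullary using (¬_; yes; no)
open import Relation.Nullary.Decidable using (decidable-stable)

-- In W the four cases of φ are one rule. To the right of the chosen position every entry is 1 and
-- no shifted descent, and rewriting the prefix by ρ keeps the X-mask. So x = x₀q becomes x₀cq,
-- where c is the letter at that position, and y = y₀q. The four cases are the four ways in which c
-- can be an ascent or a descent of x₀ and of y₀; that the position qualifies means that y₀ lies
-- below both x₀ and x₀c. The induction therefore runs on this data alone, and masks enter only in
-- the translation. The delicate point is that the condition on q concerns x, whereas closure of B
-- needs it for φ(x). Replacing x₀ by a larger x₀c preserves it because cq, a suffix of the word of
-- w, is reduced. Since `≤B` asks for witnesses, it cannot be extracted from a double negation. The
-- order used throughout, `≼`, is stable, so a case distinction made under double negation still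
-- yields a plain inequality. W is given only by its presentation, so the exchange property is
-- derived from it, by counting reflections modulo 2.

private variable A B : Set

module Acyclicity (M : CoxeterMatrix) where

  open CoxeterMatrix M
  open Coxeter M

  -- The Coxeter group

  wordSetoid : Setoid _ _
  wordSetoid = record
    { Carrier = Word ; _≈_ = _≈_
    ; isEquivalence = record { refl = ≈refl ; sym = ≈sym ; trans = ≈trans } }

  module ≈-R = SetoidReasoning wordSetoid

  ≡⇒≈ : ∀ {u v} → u ≡ v → u ≈ v
  ≡⇒≈ refl = ≈refl

  ++-congˡ : ∀ p {u v} → u ≈ v → p ++ u ≈ p ++ v
  ++-congˡ p (rel s t k e u v) =
    subst₂ _≈_ (++-assoc p u _) (++-assoc p u v) (rel s t k e (p ++ u) v)
  ++-congˡ p ≈refl        = ≈refl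
  ++-congˡ p (≈sym e)     = ≈sym (++-congˡ p e)
  ++-congˡ p (≈trans e f) = ≈trans (++-congˡ p e) (++-congˡ p f)

  ++-congʳ : ∀ p {u v} → u ≈ v → u ++ p ≈ v ++ p
  ++-congʳ p (rel s t k e u v) =
    subst₂ _≈_ (sym (trans (++-assoc u _ p) (cong (u ++_) (++-assoc _ v p))))
               (sym (++-assoc u v p)) (rel s t k e u (v ++ p))
  ++-congʳ p ≈refl        = ≈refl
  ++-congʳ p (≈sym e)     = ≈sym (++-congʳ p e)
  ++-congʳ p (≈trans e f) = ≈trans (++-congʳ p e) (++-congʳ p f)

  ++-cong : ∀ {u u' v v'} → u ≈ u' → v ≈ v' → u ++ v ≈ u' ++ v'
  ++-cong {u' = u'} {v = v} e f = ≈trans (++-congʳ v e) (++-congˡ u' f)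

  involˡ : ∀ s x → s ∷ s ∷ x ≈ x
  involˡ s x = rel s s 1 (m-diag s) [] x

  involʳ : ∀ x s → (x ∷ʳ s) ∷ʳ s ≈ x
  involʳ x s = ≈trans (≡⇒≈ (++-assoc x _ _))
    (≈trans (++-congˡ x (involˡ s [])) (≡⇒≈ (++-identityʳ x)))

  transposeˡ : ∀ s {x y} → s ∷ x ≈ y → x ≈ s ∷ y
  transposeˡ s {x} e = ≈trans (≈sym (involˡ s x)) (++-congˡ [ s ] e)

  inverseʳ : ∀ x → x ++ reverse x ≈ []
  inverseʳ []      = ≈refl
  inverseʳ (s ∷ x) = begin
    s ∷ x ++ reverse (s ∷ x)      ≡⟨ cong (λ z → s ∷ x ++ z) (unfold-reverse s x) ⟩
    s ∷ x ++ (reverse x ∷ʳ s)     ≡⟨ cong (s ∷_) (++-assoc x (reverse x) [ s ]) ⟨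
    [ s ] ++ (x ++ reverse x) ++ [ s ] ≈⟨ ++-congˡ [ s ] (++-congʳ [ s ] (inverseʳ x)) ⟩
    s ∷ s ∷ []                    ≈⟨ involˡ s [] ⟩
    []                            ∎
    where open ≈-R

  inverseˡ : ∀ x → reverse x ++ x ≈ []
  inverseˡ x = subst (λ z → reverse x ++ z ≈ []) (reverse-involutive x) (inverseʳ (reverse x))

  cancelˡ : ∀ x {y z} → x ++ y ≈ x ++ z → y ≈ z
  cancelˡ []      e = e
  cancelˡ (s ∷ x) e = cancelˡ x (≈trans (transposeˡ s e) (involˡ s _))

  reverse-cong : ∀ {u v} → u ≈ v → reverse u ≈ reverse v
  reverse-cong {u} {v} e = cancelˡ u (≈trans (inverseʳ u)
    (≈sym (≈trans (++-congʳ (reverse v) e) (inverseʳ v))))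

  parity : ℕ → Bool
  parity zero    = false
  parity (suc n) = not (parity n)

  parity-+ : ∀ m n → parity (m + n) ≡ parity m xor parity n
  parity-+ zero    n = refl
  parity-+ (suc m) n with parity m | parity-+ m n
  ... | false | e = cong not e
  ... | true  | e = trans (cong not e) (not-involutive _)

  -- Every Coxeter relator has even length.
  length-parity : ∀ {u v} → u ≈ v → parity (length u) ≡ parity (length v)
  length-parity (rel s t k _ u v) = go u
    where
    relator : ∀ k → parity (length (concat (replicate k (s ∷ t ∷ [])) ++ v)) ≡ parity (length v)
    relator zero    = refl
    relator (suc k) = trans (not-involutive _) (relator k)
    go : ∀ u → parity (length (u ++ concat (replicate k (s ∷ t ∷ [])) ++ v)) ≡ parity (length (u ++ v))
    go []      = relator k
    go (_ ∷ u) = cong not (go u)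
  length-parity ≈refl        = refl
  length-parity (≈sym e)     = sym (length-parity e)
  length-parity (≈trans e f) = trans (length-parity e) (length-parity f)

  em : ∀ {ℓ} (P : Set ℓ) → ¬ ¬ (P ⊎ ¬ P)
  em P k = k (inj₂ λ p → k (inj₁ p))

  -- Strong induction on length: `u` itself can be offered as reduced, since a shorter word for it
  -- would by induction already lead to the goal.
  reduced-exists : ∀ u → ¬ ¬ (∃[ r ] ReducedExpr r u)
  reduced-exists u = go (suc (length u)) u ≤-refl
    where
    go : ∀ n u → length u < n → ¬ ¬ (∃[ r ] ReducedExpr r u)
    go (suc n) u lt k = k (u , (λ r' e → ≮⇒≥ λ lt' →
      go n r' (≤-trans lt' (≤-pred lt)) λ { (r , red , e') → k (r , red , ≈trans e' e) }) , ≈refl)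

  minimal⇒reduced : ∀ {r r'} → IsReduced r → r' ≈ r → length r' ≤ length r → IsReduced r'
  minimal⇒reduced red e le q f = ≤-trans le (red q (≈trans f e))

  -- Minimality of both words bounds the difference of the lengths by 1, and `length-parity`
  -- excludes equality.
  length-∷ : ∀ s {r r'} → IsReduced r → IsReduced r' → r' ≈ s ∷ r →
             length r' ≡ suc (length r) ⊎ length r ≡ suc (length r')
  length-∷ s {r} {r'} red red' e with m≤n⇒m<n∨m≡n (red' (s ∷ r) (≈sym e))
  ... | inj₂ eq = inj₁ eq
  ... | inj₁ (s≤s lt) with m≤n⇒m<n∨m≡n (red (s ∷ r') (≈sym (transposeˡ s (≈sym e))))
  ... | inj₂ eq = inj₂ eq
  ... | inj₁ (s≤s lt') = ⊥-elim (not-¬ (cong parity (≤-antisym lt lt')) (length-parity e))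

  -- Reflections and strong exchange

  -- Cnt t l b says that t occurs in l an even (b = false) or odd number of times.  Equality in W is
  -- undecidable, so this is a relation, total only up to ¬¬.
  data Cnt (t : Word) : List Word → Bool → Set where
    nil  : Cnt t [] false
    hit  : ∀ {x l b} → t ≈ x → Cnt t l b → Cnt t (x ∷ l) (not b)
    miss : ∀ {x l b} → ¬ t ≈ x → Cnt t l b → Cnt t (x ∷ l) b

  Cnt-unique : ∀ {t l b b'} → Cnt t l b → Cnt t l b' → b ≡ b'
  Cnt-unique nil        nil          = refl
  Cnt-unique (hit _ c)  (hit _ c')   = cong not (Cnt-unique c c')
  Cnt-unique (hit e _)  (miss ¬e _)  = ⊥-elim (¬e e)
  Cnt-unique (miss ¬e _) (hit e _)   = ⊥-elim (¬e e)
  Cnt-unique (miss _ c) (miss _ c')  = Cnt-unique c c'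

  Cnt-total : ∀ t l → ¬ ¬ (∃[ b ] Cnt t l b)
  Cnt-total t []      k = k (_ , nil)
  Cnt-total t (x ∷ l) k = Cnt-total t l λ { (b , c) → em (t ≈ x) λ
    { (inj₁ e) → k (_ , hit e c) ; (inj₂ ¬e) → k (_ , miss ¬e c) } }

  Cnt-++ : ∀ {t l l' b b'} → Cnt t l b → Cnt t l' b' → Cnt t (l ++ l') (b xor b')
  Cnt-++ nil c' = c'
  Cnt-++ {b' = b'} (hit {b = b} e c) c' = subst (Cnt _ _) (not-distribˡ-xor b b') (hit e (Cnt-++ c c'))
  Cnt-++ (miss ¬e c) c' = miss ¬e (Cnt-++ c c')

  Cnt-transport : ∀ {t t' l l' b} →
    Pointwise (λ x x' → (t ≈ x → t' ≈ x') × (t' ≈ x' → t ≈ x)) l l' → Cnt t l b → Cnt t' l' b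
  Cnt-transport []             nil         = nil
  Cnt-transport ((f , _) ∷ pw) (hit e c)   = hit (f e) (Cnt-transport pw c)
  Cnt-transport ((_ , g) ∷ pw) (miss ¬e c) = miss (¬e ∘ g) (Cnt-transport pw c)

  Cnt-≈ : ∀ {t l l' b} → Pointwise _≈_ l l' → Cnt t l b → Cnt t l' b
  Cnt-≈ pw = Cnt-transport (PW.map (λ e → (λ f → ≈trans f e) , (λ f → ≈trans f (≈sym e))) pw)

  Cnt-map : ∀ {t t' f l b} → (∀ x → (t ≈ x → t' ≈ f x) × (t' ≈ f x → t ≈ x)) →
            Cnt t l b → Cnt t' (map f l) b
  Cnt-map {f = f} h = Cnt-transport (go _)
    where
    go : ∀ l → Pointwise _ l (map f l)
    go []      = []
    go (x ∷ l) = h x ∷ go l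

  -- Conjugation by u, nested letter by letter so that `conj-++` and `refls-++` hold as equalities
  -- of words rather than in W.
  conj : Word → Word → Word
  conj []      x = x
  conj (s ∷ u) x = s ∷ (conj u x ∷ʳ s)

  conj-++ : ∀ u v x → conj (u ++ v) x ≡ conj u (conj v x)
  conj-++ []      v x = refl
  conj-++ (s ∷ u) v x = cong (λ z → s ∷ (z ∷ʳ s)) (conj-++ u v x)

  conj-expand : ∀ u x → conj u x ≡ u ++ x ++ reverse u
  conj-expand []      x = sym (++-identityʳ x)
  conj-expand (s ∷ u) x = cong (s ∷_) (trans (cong (_∷ʳ s) (conj-expand u x))
    (trans (++-assoc u _ _) (cong (u ++_) (trans (++-assoc x _ _) (cong (x ++_) (sym (unfold-reverse s u)))))))

  conj-cong : ∀ u {x y} → x ≈ y → conj u x ≈ conj u y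
  conj-cong []      e = e
  conj-cong (s ∷ u) e = ++-congˡ [ s ] (++-congʳ [ s ] (conj-cong u e))

  conj-cong₂ : ∀ {u v} x → u ≈ v → conj u x ≈ conj v x
  conj-cong₂ {u} {v} x e = subst₂ _≈_ (sym (conj-expand u x)) (sym (conj-expand v x))
    (++-cong e (++-congˡ x (reverse-cong e)))

  conj-inverse : ∀ u x → conj (reverse u) (conj u x) ≈ x
  conj-inverse u x = subst (_≈ x) (conj-++ (reverse u) u x) (conj-cong₂ x (inverseˡ u))

  conj-adjoint : ∀ u t x → (conj (reverse u) t ≈ x → t ≈ conj u x) × (t ≈ conj u x → conj (reverse u) t ≈ x)
  conj-adjoint u t x =
    (λ e → ≈trans (≈sym (subst (_≈ t) (conj-++ u (reverse u) t) (conj-cong₂ t (inverseʳ u)))) (conj-cong u e)) ,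
    (λ e → ≈trans (conj-cong (reverse u) e) (conj-inverse u x))

  -- The reflections s₁, s₁s₂s₁, s₁s₂s₃s₂s₁, … of the word s₁s₂s₃⋯.
  refls : Word → List Word
  refls []      = []
  refls (s ∷ r) = [ s ] ∷ map (conj [ s ]) (refls r)

  refls-++ : ∀ u v → refls (u ++ v) ≡ refls u ++ map (conj u) (refls v)
  refls-++ []      v = sym (map-id (refls v))
  refls-++ (s ∷ u) v = cong ([ s ] ∷_) (trans (cong (map (conj [ s ])) (refls-++ u v))
    (trans (map-++ (conj [ s ]) (refls u) _) (cong (map (conj [ s ]) (refls u) ++_) (sym (map-∘ (refls v))))))

  Cnt-conj : ∀ u {t l b} → Cnt (conj (reverse u) t) l b → Cnt t (map (conj u) l) b
  Cnt-conj u {t} = Cnt-map (conj-adjoint u t)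

  applyUpTo-+ : ∀ {A : Set} (f : ℕ → A) m n → applyUpTo f (m + n) ≡ applyUpTo f m ++ applyUpTo (f ∘ (m +_)) n
  applyUpTo-+ f zero    n = refl
  applyUpTo-+ f (suc m) n = cong (f 0 ∷_) (applyUpTo-+ (f ∘ suc) m n)

  applyUpTo-≈ : ∀ {f g : ℕ → Word} → (∀ i → f i ≈ g i) → ∀ n → Pointwise _≈_ (applyUpTo f n) (applyUpTo g n)
  applyUpTo-≈ h zero    = []
  applyUpTo-≈ h (suc n) = h 0 ∷ applyUpTo-≈ (h ∘ suc) n

  module _ (s t : S) where

    power : ℕ → Word
    power k = concat (replicate k (s ∷ t ∷ []))

    power-+ : ∀ m n → power (m + n) ≡ power m ++ power n
    power-+ zero    n = refl
    power-+ (suc m) n = cong (λ z → s ∷ t ∷ z) (power-+ m n)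

    power-snoc : ∀ i → power i ++ s ∷ t ∷ [] ≡ power (suc i)
    power-snoc i = trans (sym (power-+ i 1)) (cong power (+-comm i 1))

    dihedral : ℕ → Word
    dihedral i = power i ∷ʳ s

    dihedral-conj : ∀ i → conj (s ∷ t ∷ []) (dihedral i) ≈ dihedral (2 + i)
    dihedral-conj i = begin
      s ∷ t ∷ (((power i ∷ʳ s) ∷ʳ t) ∷ʳ s)
        ≡⟨ cong (λ z → s ∷ t ∷ (z ∷ʳ s)) (trans (++-assoc (power i) _ _) (power-snoc i)) ⟩
      s ∷ t ∷ (power (suc i) ∷ʳ s) ∎
      where open ≈-R

    -- Each factor st contributes two reflections, and conjugation by st moves the index up by two.
    refls-power : ∀ k → Pointwise _≈_ (refls (power k)) (applyUpTo dihedral (k + k))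
    refls-power zero    = []
    refls-power (suc k) rewrite +-suc k k =
      ≈refl ∷ (≈refl ∷ PW.transitive ≈trans
        (subst (λ l → Pointwise _≈_ l (map (conj (s ∷ t ∷ [])) (applyUpTo dihedral (k + k))))
               (map-∘ (refls (power k)))
               (PW.map⁺ _ _ (PW.map (conj-cong (s ∷ t ∷ [])) (refls-power k))))
        (subst (λ l → Pointwise _≈_ l (applyUpTo (dihedral ∘ (2 +_)) (k + k)))
               (sym (map-applyUpTo dihedral (conj (s ∷ t ∷ [])) (k + k)))
               (applyUpTo-≈ dihedral-conj (k + k))))

    -- If (st)ᵏ = 1, the 2k reflections of the relator repeat with period k.
    relator-even : ∀ k → power k ≈ [] → ∀ x {b} → Cnt x (refls (power k)) b → b ≡ false
    relator-even k e x c = decidable-stable (_ ≟B _) λ ne →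
      Cnt-total x (applyUpTo dihedral k) λ { (b' , c') →
        ne (trans (Cnt-unique (Cnt-≈ (refls-power k) c)
             (subst (λ l → Cnt x l (b' xor b')) (sym (applyUpTo-+ dihedral k k))
               (Cnt-++ c' (Cnt-≈ (applyUpTo-≈ period k) c'))))
           (xor-same b')) }
      where
      period : ∀ i → dihedral i ≈ dihedral (k + i)
      period i = ≈sym (≈trans (≡⇒≈ (trans (cong (_∷ʳ s) (power-+ k i)) (++-assoc (power k) _ _)))
                              (++-congʳ (dihedral i) e))

  -- The cocycle of the action of W on reflections times {±1}, in relational form. `N-++` is the
  -- cocycle identity, and `N-invariant` makes it a function on W.
  N : Word → Word → Bool → Set
  N r t b = Cnt t (refls r) b

  N-++ : ∀ u v {t b b'} → N u t b → N v (conj (reverse u) t) b' → N (u ++ v) t (b xor b')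
  N-++ u v {t} c c' = subst (λ l → Cnt t l _) (sym (refls-++ u v)) (Cnt-++ c (Cnt-conj u c'))

  N-resp : ∀ r {t t' b} → t ≈ t' → N r t b → N r t' b
  N-resp r e = Cnt-transport (go (refls r))
    where
    go : ∀ l → Pointwise _ l l
    go []      = []
    go (x ∷ l) = ((λ f → ≈trans (≈sym e) f) , (λ f → ≈trans e f)) ∷ go l

  -- `N-++` cuts the word into u, the relator X and v. The relator contributes an even count, and,
  -- being trivial in W, it does not change the conjugate of the reflection that is counted in v.
  N-invariant : ∀ {r r'} → r ≈ r' → ∀ {t b b'} → N r t b → N r' t b' → b ≡ b'
  N-invariant (rel s t k m≡k u v) {x} {b} {b'} c c' = decidable-stable (_ ≟B _) λ ne →
    Cnt-total x (refls u) λ { (bu , cu) →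
    Cnt-total (conj (reverse u) x) (refls v) λ { (bv , cv) →
    Cnt-total (conj (reverse u) x) (refls X) λ { (bX , cX) →
    ne (trans (Cnt-unique c (N-++ u (X ++ v) cu (N-++ X v cX
                (N-resp v (≈sym (conj-cong₂ {reverse X} {[]} _ (reverse-cong X≈1))) cv))))
       (trans (cong (λ z → bu xor (z xor bv)) (relator-even s t k X≈1 _ cX))
              (sym (Cnt-unique c' (N-++ u v cu cv))))) } } }
    where
    X : Word
    X = concat (replicate k (s ∷ t ∷ []))
    X≈1 : X ≈ []
    X≈1 = subst (_≈ []) (++-identityʳ X) (rel s t k m≡k [] [])
  N-invariant ≈refl c c' = Cnt-unique c c'
  N-invariant (≈sym e) c c' = sym (N-invariant e c' c)
  N-invariant (≈trans {v = v} e f) c c' = decidable-stable (_ ≟B _) λ ne →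
    Cnt-total _ (refls v) λ { (_ , c'') → ne (trans (N-invariant e c c'') (N-invariant f c'' c')) }

  data Reflection : Word → Set where
    simple : ∀ s → Reflection [ s ]
    conj₁  : ∀ s {t} → Reflection t → Reflection (conj [ s ] t)

  reflection-invol : ∀ {t} → Reflection t → ∀ x → t ++ t ++ x ≈ x
  reflection-invol (simple s) x = involˡ s x
  reflection-invol (conj₁ s {t} ρ) x = begin
    s ∷ (t ∷ʳ s) ++ s ∷ (t ∷ʳ s) ++ x  ≡⟨ cong (s ∷_) (trans (++-assoc t _ _) (cong (λ z → t ++ s ∷ s ∷ z) (++-assoc t _ _))) ⟩
    [ s ] ++ t ++ s ∷ s ∷ t ++ s ∷ x   ≈⟨ ++-congˡ [ s ] (++-congˡ t (involˡ s _)) ⟩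
    [ s ] ++ t ++ t ++ s ∷ x           ≈⟨ ++-congˡ [ s ] (reflection-invol ρ (s ∷ x)) ⟩
    s ∷ s ∷ x                          ≈⟨ involˡ s x ⟩
    x                                  ∎
    where open ≈-R

  reflection-conj-self : ∀ {t} → Reflection t → conj (reverse t) t ≈ t
  reflection-conj-self {t} ρ = proj₂ (conj-adjoint t t t)
    (subst (t ≈_) (sym (conj-expand t t)) (≈sym (≈trans (reflection-invol ρ (reverse t)) (rev ρ))))
    where
    rev : ∀ {t} → Reflection t → reverse t ≈ t
    rev {t} ρ = cancelˡ t (≈trans (inverseʳ t)
      (≈sym (subst (λ z → t ++ z ≈ []) (++-identityʳ t) (reflection-invol ρ []))))

  -- In the word sts the two outer letters count alike, both exactly when s = t in W. They cancel
  -- modulo 2, which leaves the odd count of the middle part.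
  N-self : ∀ {t} → Reflection t → ¬ ¬ N t t true
  N-self (simple s) k = k (hit ≈refl nil)
  N-self (conj₁ s {t} ρ) k = N-self ρ λ c → em ([ s ] ≈ t) λ
    { (inj₁ e) → k (N-++ [ s ] (t ∷ʳ s) {t'} {true} {false} (hit (eq⇒ e) nil)
                   (N-++ t [ s ] {conj [ s ] t'} {true} {true} (N-resp t tt' c) (hit (eq₂ e) nil)))
    ; (inj₂ ¬e) → k (N-++ [ s ] (t ∷ʳ s) {t'} {false} {true} (miss (λ f → ¬e (⇒eq f)) nil)
                   (N-++ t [ s ] {conj [ s ] t'} {true} {false} (N-resp t tt' c) (miss (λ f → ¬e (⇒eq₂ f)) nil))) }
    where
    t' : Word
    t' = conj [ s ] t
    tt' : t ≈ conj [ s ] t'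
    tt' = ≈sym (conj-inverse [ s ] t)
    eq⇒ : [ s ] ≈ t → t' ≈ [ s ]
    eq⇒ e = ≈trans (conj-cong [ s ] (≈sym e)) (involˡ s [ s ])
    ⇒eq : t' ≈ [ s ] → [ s ] ≈ t
    ⇒eq f = ≈trans (≈sym (involˡ s [ s ])) (≈trans (conj-cong [ s ] (≈sym f)) (conj-inverse [ s ] t))
    same : conj (reverse t) (conj [ s ] t') ≈ t
    same = ≈trans (conj-cong (reverse t) (conj-inverse [ s ] t)) (reflection-conj-self ρ)
    eq₂ : [ s ] ≈ t → conj (reverse t) (conj [ s ] t') ≈ [ s ]
    eq₂ e = ≈trans same (≈sym e)
    ⇒eq₂ : conj (reverse t) (conj [ s ] t') ≈ [ s ] → [ s ] ≈ t
    ⇒eq₂ f = ≈sym (≈trans (≈sym same) f)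

  data Del : Word → Word → Set where
    here  : ∀ {s r} → Del (s ∷ r) r
    there : ∀ {s r r⁻} → Del r r⁻ → Del (s ∷ r) (s ∷ r⁻)

  Del-length : ∀ {r r⁻} → Del r r⁻ → length r ≡ suc (length r⁻)
  Del-length here      = refl
  Del-length (there d) = cong suc (Del-length d)

  odd⇒occurs : ∀ {t l b} → Cnt t l b → b ≡ true → Any (t ≈_) l
  odd⇒occurs (hit e _)  _  = here e
  odd⇒occurs (miss _ c) eq = there (odd⇒occurs c eq)

  -- Left multiplication by the i-th reflection of a word cancels its i-th letter.
  occurs⇒deletion : ∀ r {t} → Any (t ≈_) (refls r) → ∃[ r⁻ ] (Del r r⁻ × t ++ r ≈ r⁻)
  occurs⇒deletion (s ∷ r) (here e) = r , here , ≈trans (++-congʳ (s ∷ r) e) (involˡ s r)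
  occurs⇒deletion (s ∷ r) {t} (there o)
    with occurs⇒deletion r (Any.map (λ {x} → proj₂ (conj-adjoint [ s ] t x)) (AnyP.map⁻ o))
  ... | r⁻ , d , e = s ∷ r⁻ , there d , transposeˡ s (subst (_≈ r⁻) (cong (s ∷_) (++-assoc t _ _)) e)

  odd⇒deletion : ∀ r {t} → N r t true → ∃[ r⁻ ] (Del r r⁻ × t ++ r ≈ r⁻)
  odd⇒deletion r c = occurs⇒deletion r (odd⇒occurs c refl)

  -- If t had even multiplicity in r, it would have odd multiplicity in r', so t r' ≈ r would be
  -- shorter than r'.
  strong-exchange : ∀ {t r r'} → Reflection t → IsReduced r → r' ≈ t ++ r → length r' < length r →
                    ∀ q → q ≈ r → ¬ ¬ (∃[ q⁻ ] (Del q q⁻ × t ++ q ≈ q⁻))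
  strong-exchange {t} {r} {r'} ρ red e lt q q≈r k =
    Cnt-total t (refls q) λ
    { (true , c)  → k (odd⇒deletion q c)
    ; (false , c) → N-self ρ λ ct →
      Cnt-total t (refls r') λ
      { (false , c') → absurd (N-invariant (≈trans e (++-congˡ t (≈sym q≈r))) c'
                         (N-++ t q ct (N-resp q (≈sym (reflection-conj-self ρ)) c)))
      ; (true , c') → let (r⁻ , d , f) = odd⇒deletion r' c' in
          <-irrefl refl (≤-trans lt (≤-trans (red r⁻ (≈trans (≈sym f)
            (≈trans (++-congˡ t e) (reflection-invol ρ r))))
            (≤-trans (n≤1+n _) (≤-reflexive (sym (Del-length d))))) ) } }
    where
    absurd : false ≡ true → ⊥
    absurd ()

  -- Bruhat order

  reduced-suffix : ∀ p {r} → IsReduced (p ++ r) → IsReduced r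
  reduced-suffix p {r} red r' e = +-cancelˡ-≤ (length p) _ _
    (subst₂ _≤_ (length-++ p) (length-++ p) (red (p ++ r') (++-congˡ p e)))

  reduced-prefix : ∀ r {p} → IsReduced (r ++ p) → IsReduced r
  reduced-prefix r {p} red r' e = +-cancelʳ-≤ (length p) _ _
    (subst₂ _≤_ (length-++ r) (length-++ r') (red (r' ++ p) (++-congʳ p e)))

  Del⇒⊆ : ∀ {r r⁻} → Del r r⁻ → r⁻ ⊆ r
  Del⇒⊆ here      = skip _ ⊆-refl
  Del⇒⊆ (there d) = refl ∷ Del⇒⊆ d

  -- The Bruhat order by reflections: a chain of left multiplications by reflections, each raising
  -- the length. Every step carries its own reduced words, since the length of an element cannot be
  -- computed.
  infix 4 _≤T_
  data _≤T_ : Word → Word → Set where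
    done : ∀ {u v} → u ≈ v → u ≤T v
    step : ∀ {t r r' u v} → Reflection t → IsReduced r → IsReduced r' → r ≈ u → r' ≈ t ++ r →
           length r < length r' → r' ≤T v → u ≤T v

  ≤T-respˡ : ∀ {u u' v} → u ≈ u' → u ≤T v → u' ≤T v
  ≤T-respˡ e (done f)                  = done (≈trans (≈sym e) f)
  ≤T-respˡ e (step ρ red red' f g l c) = step ρ red red' (≈trans f e) g l c

  ≤T-trans : ∀ {u v w} → u ≤T v → v ≤T w → u ≤T w
  ≤T-trans (done e)                  d = ≤T-respˡ (≈sym e) d
  ≤T-trans (step ρ red red' f g l c) d = step ρ red red' f g l (≤T-trans c d)

  reflection-parity : ∀ {t} → Reflection t → parity (length t) ≡ true
  reflection-parity (simple s) = refl
  reflection-parity (conj₁ s {t} ρ) rewrite length-++ t {[ s ]} | parity-+ (length t) 1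
    | reflection-parity ρ = refl

  -- If sr < r, then sr lies below r'. Otherwise sts takes sr to sr', which is a chain step when sr'
  -- is the longer one; parity excludes equal lengths. If sr' is the shorter one, strong exchange
  -- deletes a letter of the word sr: deleting s gives sr = r', and deleting a later letter would
  -- make r' shorter than r.
  lift-step : ∀ {t r r'} s → Reflection t → IsReduced r → IsReduced r' → r' ≈ t ++ r →
              length r < length r' → ¬ ¬ (s ∷ r ≤T r' ⊎ s ∷ r ≤T s ∷ r')
  lift-step {t} {r} {r'} s ρ red red' e lt k =
    reduced-exists (s ∷ r) λ { (q , redq , f) →
    reduced-exists (s ∷ r') λ { (q' , redq' , f') → main q q' redq redq' f f' (length-∷ s red redq f) } }
    where
    main : ∀ q q' → IsReduced q → IsReduced q' → q ≈ s ∷ r → q' ≈ s ∷ r' →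
           length q ≡ suc (length r) ⊎ length r ≡ suc (length q) → ⊥
    main q q' redq redq' f f' (inj₂ eq) =
      k (inj₁ (step (simple s) redq red f (transposeˡ s (≈sym f)) (≤-reflexive (sym eq))
              (step ρ red red' ≈refl e lt (done ≈refl))))
    main q q' redq redq' f f' (inj₁ eq) with <-cmp (length q) (length q')
    ... | tri< l _ _ = k (inj₂ (step (conj₁ s ρ) redq redq' f e' l (done f')))
      where
      e' : q' ≈ conj [ s ] t ++ q
      e' = begin
        q'                        ≈⟨ f' ⟩
        s ∷ r'                    ≈⟨ ++-congˡ [ s ] e ⟩
        s ∷ t ++ r                ≈⟨ ++-congˡ (s ∷ t) (transposeˡ s (≈sym f)) ⟩
        s ∷ t ++ [ s ] ++ q       ≡⟨ cong (s ∷_) (++-assoc t [ s ] q) ⟨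
        conj [ s ] t ++ q         ∎
        where open ≈-R
    ... | tri≈ _ l _ = not-¬ (cong parity (sym l))
      (trans (length-parity f') (cong not (trans (length-parity e) (trans pt (sym (length-parity f))))))
      where
      pt : parity (length (t ++ r)) ≡ not (parity (length r))
      pt rewrite length-++ t {r} | parity-+ (length t) (length r) | reflection-parity ρ = refl
    ... | tri> _ _ l = strong-exchange (conj₁ s ρ) redq e' l (s ∷ r) (≈sym f) λ
      { (_ , here , g)  → k (inj₁ (done (transposeˡ' (≈trans (sr' ) g))))
      ; (_ , there {r⁻ = r⁻} d , g) →
          <-irrefl refl (≤-trans lt (≤-trans (red' r⁻ (≈sym (cancelˡ [ s ] (≈trans sr' g))))
            (≤-trans (n≤1+n _) (≤-reflexive (sym (Del-length d)))))) }
      where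
      sr' : s ∷ r' ≈ conj [ s ] t ++ s ∷ r
      sr' = begin
        s ∷ r'                     ≈⟨ ++-congˡ [ s ] e ⟩
        s ∷ t ++ r                 ≈⟨ ++-congˡ (s ∷ t) (≈sym (involˡ s r)) ⟩
        s ∷ t ++ [ s ] ++ s ∷ r    ≡⟨ cong (s ∷_) (++-assoc t [ s ] (s ∷ r)) ⟨
        conj [ s ] t ++ s ∷ r      ∎
        where open ≈-R
      e' : q' ≈ conj [ s ] t ++ q
      e' = ≈trans f' (≈trans sr' (++-congˡ (conj [ s ] t) (≈sym f)))
      transposeˡ' : s ∷ r' ≈ r → s ∷ r ≈ r'
      transposeˡ' g = ≈sym (transposeˡ s g)

  lift-chain : ∀ {u v} s → u ≤T v → ¬ ¬ (s ∷ u ≤T v ⊎ s ∷ u ≤T s ∷ v)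
  lift-chain s (done e) k = k (inj₂ (done (++-congˡ [ s ] e)))
  lift-chain {u} s (step {r = r} {r' = r'} ρ red red' f g l c) k =
    lift-step s ρ red red' g l λ
    { (inj₁ d) → k (inj₁ (≤T-respˡ (++-congˡ [ s ] f) (≤T-trans d c)))
    ; (inj₂ d) → lift-chain s c λ
      { (inj₁ d') → k (inj₁ (≤T-respˡ (++-congˡ [ s ] f) (≤T-trans d d')))
      ; (inj₂ d') → k (inj₂ (≤T-respˡ (++-congˡ [ s ] f) (≤T-trans d d'))) } }

  subword⇒chain : ∀ {q r} → IsReduced r → q ⊆ r → ¬ ¬ (q ≤T r)
  subword⇒chain red [] k = k (done ≈refl)
  subword⇒chain red (skip {ys = r} s sub) k =
    subword⇒chain (reduced-suffix [ s ] red) sub λ c →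
    k (≤T-trans c (step (simple s) (reduced-suffix [ s ] red) red ≈refl ≈refl ≤-refl (done ≈refl)))
  subword⇒chain red (_∷_ {x = s} refl sub) k =
    subword⇒chain (reduced-suffix [ s ] red) sub λ c → lift-chain s c λ
    { (inj₁ d) → k (≤T-trans d (step (simple s) (reduced-suffix [ s ] red) red ≈refl ≈refl ≤-refl (done ≈refl)))
    ; (inj₂ d) → k d }

  -- Asking for a subword in every expression of v makes ≼ transitive and ≈-invariant for free;
  -- ⊆⇒≼ is the subword property, that one reduced expression suffices.
  infix 4 _≼_
  record _≼_ (u v : Word) : Set where
    constructor mk
    field subword : ∀ r → r ≈ v → ¬ ¬ (∃[ q ] (q ⊆ r × q ≈ u))
  open _≼_

  -- Going down the chain, each reflection deletes one more letter from the subword found so far.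
  -- Strong exchange must for this purpose apply to words that need not be reduced.
  chain⇒≼ : ∀ {u v} → u ≤T v → u ≼ v
  chain⇒≼ (done e) = mk λ r f k → k (r , ⊆-refl , ≈trans f (≈sym e))
  chain⇒≼ (step {t} {r} ρ red red' f g l c) = mk λ w e k → subword (chain⇒≼ c) w e λ { (q , sub , h) →
    strong-exchange ρ red' (≈sym (≈trans (++-congˡ t g) (reflection-invol ρ r))) l q h λ { (q⁻ , d , i) →
    k (q⁻ , ⊆-trans (Del⇒⊆ d) sub , ≈trans (≈sym i) (≈trans (++-congˡ t (≈trans h g))
       (≈trans (reflection-invol ρ r) f))) } }

  ≼-stable : ∀ {u v} → ¬ ¬ (u ≼ v) → u ≼ v
  ≼-stable h = mk λ r e k → h λ p → subword p r e k

  ⊆⇒≼ : ∀ {q r} → IsReduced r → q ⊆ r → q ≼ r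
  ⊆⇒≼ red sub = ≼-stable λ k → subword⇒chain red sub λ c → k (chain⇒≼ c)

  ≈⇒≼ : ∀ {u v} → u ≈ v → u ≼ v
  ≈⇒≼ e = mk λ r f k → k (r , ⊆-refl , ≈trans f (≈sym e))

  ≼-trans : ∀ {u v w} → u ≼ v → v ≼ w → u ≼ w
  ≼-trans p p' = mk λ r e k → subword p' r e λ { (q , sub , f) → subword p q f λ { (q' , sub' , g) →
    k (q' , ⊆-trans sub' sub , g) } }

  ≼-resp : ∀ {u u' v v'} → u ≈ u' → v ≈ v' → u ≼ v → u' ≼ v'
  ≼-resp e f p = ≼-trans (≈⇒≼ (≈sym e)) (≼-trans p (≈⇒≼ f))

  ≼-length : ∀ {r r'} → IsReduced r → r ≼ r' → length r ≤ length r'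
  ≼-length {r} {r'} red p with length r ≤? length r'
  ... | yes le = le
  ... | no nle = ⊥-elim (subword p r' ≈refl λ { (q , sub , e) → nle (≤-trans (red q e) (length-mono-≤ sub)) })

  ⊆-full : ∀ {q r : Word} → q ⊆ r → length r ≤ length q → q ≡ r
  ⊆-full []          le = refl
  ⊆-full (skip y sub) le = ⊥-elim (<-irrefl refl (≤-trans le (length-mono-≤ sub)))
  ⊆-full (refl ∷ sub) le = cong (_ ∷_) (⊆-full sub (≤-pred le))

  ≼-antisym : ∀ {u v} → u ≼ v → v ≼ u → ¬ ¬ (u ≈ v)
  ≼-antisym p p' k =
    reduced-exists _ λ { (r , red , e) → reduced-exists _ λ { (r' , red' , e') →
    subword p r' e' λ { (q , sub , f) →
    k (≈trans (≈trans (≈sym f) (≡⇒≈ (⊆-full sub (≤-trans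
         (≼-length red' (≼-resp (≈sym e') (≈sym e) p')) (red q (≈trans f (≈sym e))))))) e') } } }

  ∷-≉ : ∀ s x → ¬ s ∷ x ≈ x
  ∷-≉ s x e = not-¬ refl (sym (length-parity e))

  ∷-dichotomy : ∀ s x → ¬ ¬ (s ∷ x ≼ x ⊎ x ≼ s ∷ x)
  ∷-dichotomy s x k = reduced-exists x λ { (r , red , e) → reduced-exists (s ∷ x) λ { (r' , red' , e') →
    cases r r' red red' e e' (length-∷ s red red' (≈trans e' (++-congˡ [ s ] (≈sym e)))) } }
    where
    cases : ∀ r r' → IsReduced r → IsReduced r' → r ≈ x → r' ≈ s ∷ x →
            length r' ≡ suc (length r) ⊎ length r ≡ suc (length r') → ⊥
    cases r r' red red' e e' (inj₁ eq) = k (inj₂ (≼-resp e (++-congˡ [ s ] e)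
      (⊆⇒≼ (minimal⇒reduced red' (≈trans (++-congˡ [ s ] e) (≈sym e')) (≤-reflexive (sym eq))) (skip s ⊆-refl))))
    cases r r' red red' e e' (inj₂ eq) = k (inj₁ (≼-resp e' e''
      (⊆⇒≼ (minimal⇒reduced red (≈trans e'' (≈sym e)) (≤-reflexive (sym eq))) (skip s ⊆-refl))))
      where
      e'' : s ∷ r' ≈ x
      e'' = ≈sym (transposeˡ s (≈sym e'))

  -- The lifting property, on the left and, by reversal, on the right

  descent-word : ∀ {s v} → s ∷ v ≼ v → ¬ ¬ (∃[ r ] ReducedExpr (s ∷ r) v)
  descent-word {s} {v} p k = reduced-exists v λ { (r' , red' , e') → reduced-exists (s ∷ v) λ { (r , red , e) →
    cases r r' red red' e e' (length-∷ s red' red (≈trans e (++-congˡ [ s ] (≈sym e')))) } }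
    where
    cases : ∀ r r' → IsReduced r → IsReduced r' → r ≈ s ∷ v → r' ≈ v →
            length r ≡ suc (length r') ⊎ length r' ≡ suc (length r) → ⊥
    cases r r' red red' e e' (inj₁ eq) =
      <-irrefl refl (≤-trans (≤-reflexive (sym eq)) (≼-length red (≼-resp (≈sym e) (≈sym e') p)))
    cases r r' red red' e e' (inj₂ eq) =
      k (r , minimal⇒reduced red' (≈trans e'' (≈sym e')) (≤-reflexive (sym eq)) , e'')
      where
      e'' : s ∷ r ≈ v
      e'' = ≈sym (transposeˡ s (≈sym e))

  -- As in the next two lemmas, a subword for u is read in a reduced expression of v that begins
  -- with s, and the cases are whether it uses that s.
  lift₁ˡ : ∀ {s u v} → u ≼ v → s ∷ v ≼ v → s ∷ u ≼ v
  lift₁ˡ {s} {u} p d = ≼-stable λ k → descent-word d λ { (r , red , e) → subword p (s ∷ r) e λ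
    { (_ , skip {xs = q} _ sub , f) → k (≼-resp (++-congˡ [ s ] f) e (⊆⇒≼ red (refl ∷ sub)))
    ; (_ , _∷_ {xs = q} refl sub , f) →
        k (≼-resp (transposeˡ s f) e (⊆⇒≼ red (skip s sub))) } }

  lift₂ˡ : ∀ {s u v} → u ≼ v → s ∷ v ≼ v → u ≼ s ∷ u → u ≼ s ∷ v
  lift₂ˡ {s} p d a = ≼-stable λ k → descent-word d λ { (r , red , e) → subword p (s ∷ r) e λ
    { (_ , skip _ sub , f) → k (≼-resp f (transposeˡ s e) (⊆⇒≼ (reduced-suffix [ s ] red) sub))
    ; (_ , refl ∷ sub , f) → k (≼-trans a
        (≼-resp (transposeˡ s f) (transposeˡ s e) (⊆⇒≼ (reduced-suffix [ s ] red) sub))) } }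

  lift₃ˡ : ∀ {s u v} → u ≼ v → s ∷ v ≼ v → s ∷ u ≼ u → s ∷ u ≼ s ∷ v
  lift₃ˡ {s} p d a = ≼-stable λ k → descent-word d λ { (r , red , e) → subword p (s ∷ r) e λ
    { (_ , skip _ sub , f) → k (≼-trans a (≼-resp f (transposeˡ s e) (⊆⇒≼ (reduced-suffix [ s ] red) sub)))
    ; (_ , refl ∷ sub , f) → k (≼-resp (transposeˡ s f) (transposeˡ s e) (⊆⇒≼ (reduced-suffix [ s ] red) sub)) } }

  ≼-reverse : ∀ {u v} → u ≼ v → reverse u ≼ reverse v
  ≼-reverse {u} {v} p = mk λ r e k →
    subword p (reverse r) (subst (reverse r ≈_) (reverse-involutive v) (reverse-cong e)) λ
    { (q , sub , f) → k (reverse q , subst (reverse q ⊆_) (reverse-involutive r) (reverse⁺ sub) , reverse-cong f) }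

  reverse-∷ʳ : ∀ (u : Word) s → reverse (u ∷ʳ s) ≡ s ∷ reverse u
  reverse-∷ʳ u s = reverse-++ u [ s ]

  ≼-unreverse : ∀ {u v} → reverse u ≼ reverse v → u ≼ v
  ≼-unreverse {u} {v} p = subst₂ _≼_ (reverse-involutive u) (reverse-involutive v) (≼-reverse p)

  ∷ʳ-dichotomy : ∀ x s → ¬ ¬ (x ∷ʳ s ≼ x ⊎ x ≼ x ∷ʳ s)
  ∷ʳ-dichotomy x s k = ∷-dichotomy s (reverse x) λ
    { (inj₁ p) → k (inj₁ (≼-unreverse (subst (_≼ reverse x) (sym (reverse-∷ʳ x s)) p)))
    ; (inj₂ p) → k (inj₂ (≼-unreverse (subst (reverse x ≼_) (sym (reverse-∷ʳ x s)) p))) }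

  ∷ʳ-≉ : ∀ x s → ¬ x ∷ʳ s ≈ x
  ∷ʳ-≉ x s e = ∷-≉ s (reverse x) (subst (_≈ reverse x) (reverse-∷ʳ x s) (reverse-cong e))

  private
    flipˡ : ∀ {x v} s → x ∷ʳ s ≼ v → s ∷ reverse x ≼ reverse v
    flipˡ {x} {v} s p = subst (_≼ reverse v) (reverse-∷ʳ x s) (≼-reverse p)

  lift₁ : ∀ {s u v} → u ≼ v → v ∷ʳ s ≼ v → u ∷ʳ s ≼ v
  lift₁ {s} {u} {v} p d = ≼-unreverse (subst (_≼ reverse v) (sym (reverse-∷ʳ u s))
    (lift₁ˡ (≼-reverse p) (flipˡ s d)))

  lift₂ : ∀ {s u v} → u ≼ v → v ∷ʳ s ≼ v → u ≼ u ∷ʳ s → u ≼ v ∷ʳ s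
  lift₂ {s} {u} {v} p d a = ≼-unreverse (subst (reverse u ≼_) (sym (reverse-∷ʳ v s))
    (lift₂ˡ (≼-reverse p) (flipˡ s d) (subst (reverse u ≼_) (reverse-∷ʳ u s) (≼-reverse a))))

  lift₃ : ∀ {s u v} → u ≼ v → v ∷ʳ s ≼ v → u ∷ʳ s ≼ u → u ∷ʳ s ≼ v ∷ʳ s
  lift₃ {s} {u} {v} p d a = ≼-unreverse (subst₂ _≼_ (sym (reverse-∷ʳ u s)) (sym (reverse-∷ʳ v s))
    (lift₃ˡ (≼-reverse p) (flipˡ s d) (flipˡ s a)))

  invol-≼ : ∀ {x s} → x ≼ x ∷ʳ s → (x ∷ʳ s) ∷ʳ s ≼ x ∷ʳ s
  invol-≼ {x} {s} p = ≼-trans (≈⇒≼ (involʳ x s)) p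

  lift₄ : ∀ {s u v} → u ≼ v → v ≼ v ∷ʳ s → u ∷ʳ s ≼ v ∷ʳ s
  lift₄ p a = lift₁ (≼-trans p a) (invol-≼ a)

  lift₄ˡ : ∀ {s u v} → u ≼ v → v ≼ s ∷ v → s ∷ u ≼ s ∷ v
  lift₄ˡ {s} {v = v} p a = lift₁ˡ (≼-trans p a) (≼-trans (≈⇒≼ (involˡ s v)) a)

  -- The deletion property, needed because `≼` yields an arbitrary subword while `≤B` asks for a
  -- reduced one. If a new letter s shortens the reduced r, exchange deletes a letter of r instead.
  reduced-subword : ∀ q → ¬ ¬ (∃[ r ] (r ⊆ q × ReducedExpr r q))
  reduced-subword []      k = k ([] , [] , (λ _ _ → z≤n) , ≈refl)
  reduced-subword (s ∷ q) k = reduced-subword q λ { (r , sub , red , e) →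
    reduced-exists (s ∷ r) λ { (r' , red' , e') → cases r r' sub red e red' e' (length-∷ s red red' e') } }
    where
    cases : ∀ r r' → r ⊆ q → IsReduced r → r ≈ q → IsReduced r' → r' ≈ s ∷ r →
            length r' ≡ suc (length r) ⊎ length r ≡ suc (length r') → ⊥
    cases r r' sub red e red' e' (inj₁ eq) =
      k (s ∷ r , refl ∷ sub , minimal⇒reduced red' (≈sym e') (≤-reflexive (sym eq)) , ++-congˡ [ s ] e)
    cases r r' sub red e red' e' (inj₂ eq) =
      strong-exchange (simple s) red e' (≤-reflexive (sym eq)) r ≈refl λ { (r⁻ , d , f) →
        k (r⁻ , skip s (⊆-trans (Del⇒⊆ d) sub) ,
           minimal⇒reduced red' (≈trans (≈sym f) (≈sym e'))
             (≤-reflexive (cong pred (trans (sym (Del-length d)) eq))) ,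
           ≈trans (≈sym f) (++-congˡ [ s ] e)) }

  ≤B⇒≼ : ∀ {u v} → u ≤B v → u ≼ v
  ≤B⇒≼ (r , r' , (_ , e) , (red' , e') , sub) = ≼-resp e e' (⊆⇒≼ red' sub)

  ≼⇒≤B : ∀ {u v} → u ≼ v → ¬ ¬ (u ≤B v)
  ≼⇒≤B p k = reduced-exists _ λ { (r' , red' , e') → subword p r' e' λ { (q , sub , e) →
    reduced-subword q λ { (r , sub' , red , f) →
    k (r , r' , (red , ≈trans f e) , (red' , e') , ⊆-trans sub' sub) } } }

  -- Shifted descents

  -- The letters of q, all taken with mask entry 1 after the prefix elements y (of σ) and x (of τ),
  -- are not shifted descents.
  NSD : Word → Word → Word → Set
  NSD y x []      = ⊤
  NSD y x (b ∷ q) = ¬ (y ∷ʳ b ≼ x) × NSD (y ∷ʳ b) (x ∷ʳ b) q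

  NSD-stable : ∀ {y x} q → ¬ ¬ NSD y x q → NSD y x q
  NSD-stable []      h = tt
  NSD-stable (b ∷ q) h = (λ p → h λ n → proj₁ n p) , NSD-stable q λ k → h λ n → k (proj₂ n)

  NSD-resp : ∀ {y y' x x'} q → y ≈ y' → x ≈ x' → NSD y x q → NSD y' x' q
  NSD-resp []      e f n        = tt
  NSD-resp (b ∷ q) e f (n , ns) =
    (λ p → n (≼-resp (≈sym (++-congʳ [ b ] e)) (≈sym f) p)) , NSD-resp q (++-congʳ [ b ] e) (++-congʳ [ b ] f) ns

  -- If b were a descent of x, lifting would put yb below x.
  ascent-upper : ∀ {y x b} → y ≼ x → ¬ (y ∷ʳ b ≼ x) → x ≼ x ∷ʳ b
  ascent-upper {x = x} {b} p n = ≼-stable λ k → ∷ʳ-dichotomy x b λ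
    { (inj₁ d) → n (lift₁ p d) ; (inj₂ a) → k a }

  ascent-lower : ∀ {y x b} → y ≼ x → ¬ (y ∷ʳ b ≼ x) → y ≼ y ∷ʳ b
  ascent-lower {y} {b = b} p n = ≼-stable λ k → ∷ʳ-dichotomy y b λ
    { (inj₁ d) → n (≼-trans d p) ; (inj₂ a) → k a }

  ascent-both : ∀ {y x b} → y ≼ x → ¬ (y ∷ʳ b ≼ x) → y ∷ʳ b ≼ x ∷ʳ b
  ascent-both p n = lift₄ p (ascent-upper p n)

  -- The minimum of y and ty, as a relation because it cannot be decided which of the two is
  -- smaller.
  Smaller : S → Word → Word → Set
  Smaller t y y' = (y' ≡ y × y ≼ t ∷ y) ⊎ (y' ≡ t ∷ y × t ∷ y ≼ y)

  -- If t becomes a left descent between y and yb, then yb = ty, which lies below x.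
  Smaller-∷ʳ : ∀ {t y y' x b} → t ∷ x ≼ x → y ≼ x → ¬ (y ∷ʳ b ≼ x) → Smaller t y y' → Smaller t (y ∷ʳ b) (y' ∷ʳ b)
  Smaller-∷ʳ d p n (inj₂ (refl , a)) = inj₂ (refl , lift₄ a (ascent-lower p n))
  Smaller-∷ʳ {t} {y} {x = x} {b} d p n (inj₁ (refl , a)) = inj₁ (refl , ≼-stable λ k →
    ∷-dichotomy t (y ∷ʳ b) λ
    { (inj₂ u) → k u
    ; (inj₁ u) → ∷ʳ-dichotomy (t ∷ y) b λ
      { (inj₁ v) → n (≼-trans (lift₁ a v) (lift₁ˡ p d))
      ; (inj₂ v) → ≼-antisym a (≼-resp ≈refl (involʳ y b)
          (lift₂ (≼-trans v u) (≼-trans (≈⇒≼ (involʳ y b)) (ascent-lower p n)) v))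
          λ e → ∷-≉ t y (≈sym e) } })

  -- A shifted descent over tx would by lifting be one over x. Along q, t remains a left descent of
  -- x because every letter is an ascent of x.
  NSD-down : ∀ {t y y' x} q → t ∷ x ≼ x → y ≼ x → Smaller t y y' → NSD y x q → NSD y' (t ∷ x) q
  NSD-down []      d p σ n = tt
  NSD-down {t} {y} (b ∷ q) d p σ (n , ns) =
    first σ , NSD-down q (lift₄ d (ascent-upper p n)) (ascent-both p n) (Smaller-∷ʳ d p n σ) ns
    where
    first : ∀ {y'} → Smaller t y y' → ¬ (y' ∷ʳ b ≼ t ∷ _)
    first (inj₁ (refl , _)) h = n (≼-trans h d)
    first (inj₂ (refl , _)) h = n (≼-trans (≈⇒≼ (≈sym (involˡ t _))) (lift₁ˡ (≼-trans h d) d))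

  -- A second element x, over which q is already known to have no shifted descents, accompanies x'.
  -- `Smaller-∷ʳ` needs this knowledge to follow the minimum of y and ty along q, and over x' it is
  -- the very thing to be proved.
  NSD-up : ∀ {t y y' x x'} q → t ∷ x ≼ x → y ≼ x → NSD y x q → t ∷ x' ≼ x' → y ≼ x' →
           Smaller t y y' → NSD y' (t ∷ x') q → NSD y x' q
  NSD-up []      d p n d' p' σ n' = tt
  NSD-up {t} {y} {x' = x'} (b ∷ q) d p (n , ns) d' p' σ (n' , ns') =
    first , NSD-up q (lift₄ d (ascent-upper p n)) (ascent-both p n) ns
                     (lift₄ d' (ascent-upper p' first)) (ascent-both p' first) σ' ns'
    where
    σ' = Smaller-∷ʳ d p n σ
    go : ∀ {y'} → Smaller t (y ∷ʳ b) y' → ¬ (y' ≼ t ∷ x') → ¬ (y ∷ʳ b ≼ x')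
    go (inj₁ (refl , a)) m h = m (lift₂ˡ h d' a)
    go (inj₂ (refl , a)) m h = m (lift₃ˡ h d' a)
    first : ¬ (y ∷ʳ b ≼ x')
    first = go σ' n'

  -- As pb is reduced and has the same number of letters as cp, pb ≤ cp would force pb = cp. Then
  -- cpb = p, against the reducedness of cpb.
  NSD-base : ∀ c p q → IsReduced (c ∷ p ++ q) → NSD p (c ∷ p) q
  NSD-base c p []      red = tt
  NSD-base c p (b ∷ q) red = first , NSD-base c (p ∷ʳ b) q red'
    where
    red' : IsReduced (c ∷ (p ∷ʳ b) ++ q)
    red' = subst (λ z → IsReduced (c ∷ z)) (sym (∷ʳ-++ p b q)) red
    red'' : IsReduced (c ∷ (p ∷ʳ b))
    red'' = reduced-prefix (c ∷ (p ∷ʳ b)) red'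
    first : ¬ (p ∷ʳ b ≼ c ∷ p)
    first h = subword h (c ∷ p) ≈refl λ { (q , sub , e) →
      <-irrefl refl (≤-trans (s≤s (m≤m+n (length p) 1))
        (subst (λ z → suc z ≤ length p) (length-++ p) (red'' p (transposeˡ c
          (≈trans (≡⇒≈ (sym (⊆-full sub (≤-trans (≤-reflexive (trans (+-comm 1 _) (sym (length-++ p))))
            (reduced-suffix [ c ] red'' q e))))) e))))) }

  -- Left multiplication by a left descent t of x reduces x to 1.
  NSD-ascent-reduced : ∀ x {y c} q → IsReduced x → y ≼ x → x ≼ x ∷ʳ c → NSD y x q → IsReduced (c ∷ q) →
                       NSD y (x ∷ʳ c) q
  NSD-ascent-reduced [] {c = c} q _ p a n red = NSD-stable q λ k → subword p [] ≈refl λ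
    { ([] , [] , e) → k (NSD-resp q e ≈refl (NSD-base c [] q red)) }
  NSD-ascent-reduced (t ∷ r) {y} {c} q redx p a n red = NSD-stable q λ k → ∷-dichotomy t y λ
    { (inj₁ d) → k (NSD-up q tx p n d' (≼-trans p a) (inj₂ (refl , d))
        (NSD-resp q ≈refl tc (NSD-ascent-reduced r q redr
          (≼-resp ≈refl (involˡ t r) (lift₃ˡ p tx d)) a'
          (NSD-resp q ≈refl (involˡ t r) (NSD-down q tx p (inj₂ (refl , d)) n)) red)))
    ; (inj₂ d) → k (NSD-up q tx p n d' (≼-trans p a) (inj₁ (refl , d))
        (NSD-resp q ≈refl tc (NSD-ascent-reduced r q redr
          (≼-resp ≈refl (involˡ t r) (lift₂ˡ p tx d)) a'
          (NSD-resp q ≈refl (involˡ t r) (NSD-down q tx p (inj₁ (refl , d)) n)) red))) }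
    where
    redr = reduced-suffix [ t ] redx
    r≼ : r ≼ t ∷ r
    r≼ = ⊆⇒≼ redx (skip t ⊆-refl)
    tx : t ∷ t ∷ r ≼ t ∷ r
    tx = ≼-resp (≈sym (involˡ t r)) ≈refl r≼
    tc : r ∷ʳ c ≈ t ∷ t ∷ r ∷ʳ c
    tc = ≈sym (involˡ t (r ∷ʳ c))
    d' : t ∷ t ∷ r ∷ʳ c ≼ t ∷ r ∷ʳ c
    d' = ≼-resp tc ≈refl (lift₄ r≼ a)
    -- If rc were below r, multiplying by the left ascent t of r would give trc ≤ tr, against `a`.
    a' : r ≼ r ∷ʳ c
    a' = ≼-stable λ k → ∷ʳ-dichotomy r c λ
      { (inj₂ u) → k u
      ; (inj₁ u) → ≼-antisym a (lift₄ˡ u r≼) λ e → ∷ʳ-≉ (t ∷ r) c (≈sym e) }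

  NSD-ascent : ∀ {x y c} q → y ≼ x → x ≼ x ∷ʳ c → NSD y x q → IsReduced (c ∷ q) → NSD y (x ∷ʳ c) q
  NSD-ascent {x} {y} {c} q p a n red = NSD-stable q λ k → reduced-exists x λ { (r , redr , e) →
    k (NSD-resp q ≈refl (++-congʳ [ c ] e)
      (NSD-ascent-reduced r q redr (≼-resp ≈refl (≈sym e) p)
        (≼-resp (≈sym e) (++-congʳ [ c ] (≈sym e)) a) (NSD-resp q ≈refl (≈sym e) n) red)) }

  NSD-at : ∀ {y x} a {b q} → NSD y x (a ++ b ∷ q) → ¬ ((y ++ a) ∷ʳ b ≼ x ++ a)
  NSD-at {y} {x} [] {b} (n , _) = subst₂ (λ u v → ¬ (u ∷ʳ b ≼ v)) (sym (++-identityʳ y)) (sym (++-identityʳ x)) n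
  NSD-at {y} {x} (c ∷ a) {b} (_ , ns) =
    subst₂ (λ u v → ¬ (u ∷ʳ b ≼ v)) (∷ʳ-++ y c a) (∷ʳ-++ x c a) (NSD-at a ns)

  NSD-init : ∀ {y x} q {b} → NSD y x (q ∷ʳ b) → NSD y x q
  NSD-init []      n        = tt
  NSD-init (c ∷ q) (n , ns) = n , NSD-init q ns

  NSD-snoc : ∀ {y x} q {b} → NSD y x q → ¬ ((y ++ q) ∷ʳ b ≼ x ++ q) → NSD y x (q ∷ʳ b)
  NSD-snoc {y} {x} [] {b} _ n = subst₂ (λ u v → ¬ (u ∷ʳ b ≼ v)) (++-identityʳ y) (++-identityʳ x) n , tt
  NSD-snoc {y} {x} (c ∷ q) {b} (m , ms) n =
    m , NSD-snoc q ms (subst₂ (λ u v → ¬ (u ∷ʳ b ≼ v)) (sym (∷ʳ-++ y c q)) (sym (∷ʳ-++ x c q)) n)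

  -- Every letter of q is an ascent of the growing upper element, so `lift₄` carries the inequality
  -- across q.
  NSD-mono : ∀ {y x z} q → y ≼ x → NSD y x q → z ≼ x → z ++ q ≼ x ++ q
  NSD-mono {y} {x} {z} [] p _ h = subst₂ _≼_ (sym (++-identityʳ z)) (sym (++-identityʳ x)) h
  NSD-mono {y} {x} {z} (b ∷ q) p (n , ns) h = subst₂ _≼_ (∷ʳ-++ z b q) (∷ʳ-++ x b q)
    (NSD-mono q (ascent-both p n) ns (lift₄ h (ascent-upper p n)))

  -- The matching on group elements

  -- φ on group elements: all letters of q stay, and the letter c before them is toggled.
  record Toggle (y w u v : Word) : Set where
    constructor toggle
    field
      w₁ : Word
      c  : S
      q y₀ x₀ : Word
      w≡  : w ≡ w₁ ++ c ∷ q
      y≈  : y ≈ y₀ ++ q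
      u≈  : u ≈ x₀ ++ q
      v≈  : v ≈ (x₀ ∷ʳ c) ++ q
      y₀≼ : y₀ ≼ x₀
      y₀≼c : y₀ ≼ x₀ ∷ʳ c
      nsd : NSD y₀ x₀ q

  ∷ʳ-swap : ∀ {x y s} → x ≈ y ∷ʳ s → x ∷ʳ s ≈ y
  ∷ʳ-swap {y = y} {s} e = ≈trans (++-congʳ [ s ] e) (involʳ y s)

  Toggle-resp : ∀ {y w u u' v v'} → u ≈ u' → v ≈ v' → Toggle y w u v → Toggle y w u' v'
  Toggle-resp e f (toggle w₁ c q y₀ x₀ w≡ y≈ u≈ v≈ p p' n) =
    toggle w₁ c q y₀ x₀ w≡ y≈ (≈trans (≈sym e) u≈) (≈trans (≈sym f) v≈) p p' n

  Toggle-here : ∀ {y w s u} → y ≼ u → y ≼ u ∷ʳ s → Toggle y (w ∷ʳ s) u (u ∷ʳ s)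
  Toggle-here {y} {w} {s} {u} p p' = toggle w s [] y u refl (≡⇒≈ (sym (++-identityʳ y)))
    (≡⇒≈ (sym (++-identityʳ u))) (≡⇒≈ (sym (++-identityʳ (u ∷ʳ s)))) p p' tt

  Toggle-there : ∀ {y w s u v} → ¬ (y ≼ u) → Toggle (y ∷ʳ s) w u v → Toggle y (w ∷ʳ s) (u ∷ʳ s) (v ∷ʳ s)
  Toggle-there {y} {w} {s} {u} {v} ¬p (toggle w₁ c q y₀ x₀ w≡ y≈ u≈ v≈ p p' n) =
    toggle w₁ c (q ∷ʳ s) y₀ x₀
      (trans (cong (_∷ʳ s) w≡) (++-assoc w₁ (c ∷ q) [ s ]))
      (≈trans (≈sym (∷ʳ-swap (≈sym y≈))) (≡⇒≈ (++-assoc y₀ q [ s ])))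
      (≈trans (++-congʳ [ s ] u≈) (≡⇒≈ (++-assoc x₀ q [ s ])))
      (≈trans (++-congʳ [ s ] v≈) (≡⇒≈ (++-assoc (x₀ ∷ʳ c) q [ s ])))
      p p' (NSD-snoc q n λ h → ¬p (≼-resp (∷ʳ-swap (≈sym y≈)) (≈sym u≈) h))

  Cov : Word → Word → Set
  Cov u v = v ≼ u × ¬ v ≈ u × (∀ z → v ≼ z → ¬ v ≈ z → z ≼ u → ¬ ¬ z ≈ u)

  -- The toggled letter is the last letter s or lies to its left. In the second case the source u is
  -- in B by definition of a toggle, but for the target v this is a theorem, recorded in the last
  -- argument for upward pairs.
  data ToggleView (y w : Word) (s : S) (u v : Word) : Set where
    here  : v ≈ u ∷ʳ s → y ≼ u → y ≼ u ∷ʳ s → ToggleView y w s u v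
    there : ¬ (y ≼ u ∷ʳ s) → Toggle (y ∷ʳ s) w (u ∷ʳ s) (v ∷ʳ s) →
            (Cov v u → IsReduced (w ∷ʳ s) → ¬ (y ≼ v ∷ʳ s)) → ToggleView y w s u v

  toggleView : ∀ {y w s u v} → Toggle y (w ∷ʳ s) u v → ToggleView y w s u v
  toggleView {y} {w} {s} {u} {v} (toggle w₁ c q y₀ x₀ w≡ y≈ u≈ v≈ p p' n) = go q (reverseView q) w≡ y≈ u≈ v≈ n
    where
    go : ∀ q → Reverse q → w ∷ʳ s ≡ w₁ ++ c ∷ q → y ≈ y₀ ++ q → u ≈ x₀ ++ q →
         v ≈ (x₀ ∷ʳ c) ++ q → NSD y₀ x₀ q → ToggleView y w s u v
    go .[] [] w≡ y≈ u≈ v≈ n with ∷ʳ-injective w w₁ w≡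
    ... | _ , refl = here (≈trans v≈ (≈trans (≡⇒≈ (++-identityʳ (x₀ ∷ʳ c))) (++-congʳ [ c ] (≈sym u≈'))))
                          (≼-resp (≈sym y≈') (≈sym u≈') p) (≼-resp (≈sym y≈') (++-congʳ [ c ] (≈sym u≈')) p')
      where
      y≈' : y ≈ y₀
      y≈' = ≈trans y≈ (≡⇒≈ (++-identityʳ y₀))
      u≈' : u ≈ x₀
      u≈' = ≈trans u≈ (≡⇒≈ (++-identityʳ x₀))
    go .(q ∷ʳ b) (q ∶ _ ∶ʳ b) w≡ y≈ u≈ v≈ n
      with ∷ʳ-injective w (w₁ ++ c ∷ q) (trans w≡ (sym (++-assoc w₁ (c ∷ q) [ b ])))
    ... | refl , refl = there (λ h → last n (≼-resp y≈' (∷ʳ-swap u≈') h))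
        (toggle w₁ c q y₀ x₀ refl (∷ʳ-swap y≈') (∷ʳ-swap u≈') (∷ʳ-swap v≈') p p' (NSD-init q n))
        -- If c were a descent of x₀, `NSD-mono` would put v below u, against the covering. So c is
        -- an ascent and `NSD-ascent` applies.
        λ cov red h → ∷ʳ-dichotomy x₀ c λ
        { (inj₁ d) → ≼-antisym (proj₁ cov) (≼-resp (≈sym v≈) (≈sym u≈) (NSD-mono (q ∷ʳ b) p n d)) (proj₁ (proj₂ cov))
        ; (inj₂ a) → last (NSD-ascent (q ∷ʳ b) p a n (reduced-suffix w₁
                       (subst IsReduced (++-assoc w₁ (c ∷ q) [ b ]) red)))
                     (≼-resp y≈' (∷ʳ-swap v≈') h) }
      where
      y≈' : y ≈ (y₀ ++ q) ∷ʳ b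
      y≈' = ≈trans y≈ (≡⇒≈ (sym (++-assoc y₀ q [ b ])))
      u≈' : u ≈ (x₀ ++ q) ∷ʳ b
      u≈' = ≈trans u≈ (≡⇒≈ (sym (++-assoc x₀ q [ b ])))
      v≈' : v ≈ ((x₀ ∷ʳ c) ++ q) ∷ʳ b
      v≈' = ≈trans v≈ (≡⇒≈ (sym (++-assoc (x₀ ∷ʳ c) q [ b ])))
      last : ∀ {x} → NSD y₀ x (q ∷ʳ b) → ¬ ((y₀ ++ q) ∷ʳ b ≼ x ++ q)
      last n = NSD-at q n

  -- Acyclicity on group elements, by induction on the last letter

  Matching : Word → Word → Word → Word → Set
  Matching y w u v = Toggle y w u v ⊎ Toggle y w v u

  record Edge (y w u v : Word) : Set where
    constructor edge
    field
      lower₁ : y ≼ u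
      lower₂ : y ≼ v
      dir    : (Cov u v × ¬ Matching y w u v) ⊎ (Cov v u × Matching y w u v)

  Walk : Word → Word → Word → Word → Set
  Walk y w = TransClosure (Edge y w)

  _≺_ : Word → Word → Set
  u ≺ v = u ≼ v × ¬ u ≈ v

  ≺-trans : ∀ {u v z} → u ≺ v → v ≺ z → u ≺ z
  ≺-trans (p , n) (p' , n') = ≼-trans p p' ,
    λ e → ≼-antisym p (≼-trans p' (≈⇒≼ (≈sym e))) n

  Cov-shift : ∀ {u v s} → u ∷ʳ s ≼ u → v ∷ʳ s ≼ v → Cov u v → Cov (u ∷ʳ s) (v ∷ʳ s)
  Cov-shift {u} {v} {s} du dv (p , n , h) = lift₃ p du dv , (λ e → n (cancelʳ e)) , between
    where
    cancelʳ : ∀ {x z} → x ∷ʳ s ≈ z ∷ʳ s → x ≈ z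
    cancelʳ {x} {z} e = ≈trans (≈sym (involʳ x s)) (∷ʳ-swap e)
    between : ∀ z → v ∷ʳ s ≼ z → ¬ v ∷ʳ s ≈ z → z ≼ u ∷ʳ s → ¬ ¬ z ≈ u ∷ʳ s
    between z a b c k = ∷ʳ-dichotomy z s λ
      -- If s is a descent of z, then v ≤ z ≤ us < u, so the covering forces v = us and z is
      -- squeezed. Otherwise zs lies between v and u and, differing from v, equals u.
      { (inj₁ d) → let v≼z = ≼-resp (involʳ v s) ≈refl (lift₁ a d) in
          h (u ∷ʳ s) (≼-trans v≼z c) (λ e → ≼-antisym c (≼-trans (≈⇒≼ (≈sym e)) v≼z) k) du (∷ʳ-≉ u s)
      ; (inj₂ i) → h (z ∷ʳ s) (≼-resp (involʳ v s) ≈refl (lift₄ a i)) (λ e → b (∷ʳ-swap e))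
          (lift₁ (≼-trans c du) du) λ e → k (≈sym (∷ʳ-swap (≈sym e))) }

  ≺-stable : ∀ {u v} → ¬ ¬ (u ≺ v) → u ≺ v
  ≺-stable h = ≼-stable (λ k → h λ p → k (proj₁ p)) , λ e → h λ p → proj₂ p e

  -- The vertices of [y, w] split into A = {x : y ≤ xs} and B = {x : y ≰ xs}, where s is the last letter.
  module LastLetter {y w : Word} {s : S} (red : IsReduced (w ∷ʳ s)) where

    descent : ∀ {u} → y ≼ u → ¬ (y ≼ u ∷ʳ s) → u ∷ʳ s ≼ u
    descent {u} p n = ≼-stable λ k → ∷ʳ-dichotomy u s λ
      { (inj₁ d) → k d ; (inj₂ a) → n (≼-trans p a) }

    B-closed : ∀ {u v} → Edge y (w ∷ʳ s) u v → ¬ (y ≼ u ∷ʳ s) → ¬ (y ≼ v ∷ʳ s)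
    B-closed {u} {v} (edge p p' (inj₁ ((v≼u , _) , _))) n h = ∷ʳ-dichotomy v s λ
      { (inj₁ d) → n (≼-trans h (lift₃ v≼u (descent p n) d))
      ; (inj₂ a) → n (≼-trans p' (lift₂ v≼u (descent p n) a)) }
    B-closed (edge p p' (inj₂ (cov , inj₁ m))) n h with toggleView m
    ... | here _ _ h'   = n h'
    ... | there _ _ f   = f cov red h
    B-closed (edge p p' (inj₂ (cov , inj₂ m))) n h with toggleView m
    ... | here e _ _    = n (≼-resp ≈refl (≈sym (∷ʳ-swap e)) p')
    ... | there n' _ _  = n' h

    -- The matching has to be transported both ways: `down` carries matched edges to [ys, ws], and
    -- `up` shows that unmatched edges stay unmatched there.
    B-edge : ∀ {u v} → Edge y (w ∷ʳ s) u v → ¬ (y ≼ u ∷ʳ s) → Edge (y ∷ʳ s) w (u ∷ʳ s) (v ∷ʳ s)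
    B-edge {u} {v} e@(edge p p' d) n = edge (lower p n) (lower p' n') (dir d)
      where
      n' = B-closed e n
      lower : ∀ {x} → y ≼ x → ¬ (y ≼ x ∷ʳ s) → y ∷ʳ s ≼ x ∷ʳ s
      lower {x} p n = ≼-stable λ k → ∷ʳ-dichotomy y s λ
        { (inj₁ d) → k (lift₃ p (descent p n) d)
        ; (inj₂ a) → n (lift₂ p (descent p n) a) }
      up : ∀ {x z} → ¬ (y ≼ x ∷ʳ s) → Toggle (y ∷ʳ s) w (x ∷ʳ s) (z ∷ʳ s) → Toggle y (w ∷ʳ s) x z
      up {x} {z} n m = Toggle-resp (involʳ x s) (involʳ z s) (Toggle-there n m)
      down : ∀ {x z} → ¬ (y ≼ x ∷ʳ s) → Toggle y (w ∷ʳ s) x z → Toggle (y ∷ʳ s) w (x ∷ʳ s) (z ∷ʳ s)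
      down n m with toggleView m
      ... | here _ _ h  = ⊥-elim (n h)
      ... | there _ t _ = t
      dir : (Cov u v × ¬ Matching y (w ∷ʳ s) u v) ⊎ (Cov v u × Matching y (w ∷ʳ s) u v) →
            (Cov (u ∷ʳ s) (v ∷ʳ s) × ¬ Matching (y ∷ʳ s) w (u ∷ʳ s) (v ∷ʳ s)) ⊎
            (Cov (v ∷ʳ s) (u ∷ʳ s) × Matching (y ∷ʳ s) w (u ∷ʳ s) (v ∷ʳ s))
      dir (inj₁ (c , ¬m)) = inj₁ (Cov-shift (descent p n) (descent p' n') c , λ m → ¬m (Sum.map (up n) (up n') m))
      dir (inj₂ (c , m))  = inj₂ (Cov-shift (descent p' n') (descent p n) c , Sum.map (down n) (down n') m)

    A-matched : ∀ {u v} → Matching y (w ∷ʳ s) u v → y ≼ u ∷ʳ s → y ≼ v ∷ʳ s → v ≈ u ∷ʳ s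
    A-matched (inj₁ m) h h' with toggleView m
    ... | here e _ _  = e
    ... | there n _ _ = ⊥-elim (n h)
    A-matched (inj₂ m) h h' with toggleView m
    ... | here e _ _  = ≈sym (∷ʳ-swap e)
    ... | there n _ _ = ⊥-elim (n h')

    descent-edge : ∀ {u v} → Edge y (w ∷ʳ s) u v → u ∷ʳ s ≼ u → y ≼ u ∷ʳ s → y ≼ v ∷ʳ s →
                   (v ∷ʳ s ≼ v) × (v ≺ u)
    descent-edge {u} {v} (edge p p' (inj₁ (cov@(v≼u , v≉u , h) , ¬m))) d yu yv =
      (≼-stable λ k → ∷ʳ-dichotomy v s λ
      { (inj₁ d') → k d'
      -- Lifting puts us between v and u, so v = us by the covering; but u and us are matched, and
      -- this edge is not.
      ; (inj₂ a) → h (u ∷ʳ s) (lift₂ v≼u d a)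
          (λ e → ¬m (inj₁ (Toggle-resp ≈refl (≈sym e) (Toggle-here p yu)))) d (∷ʳ-≉ u s) }) , v≼u , v≉u
    descent-edge (edge p p' (inj₂ ((u≼v , u≉v , _) , m))) d yu yv =
      ⊥-elim (≼-antisym u≼v (≼-trans (≈⇒≼ (A-matched m yu yv)) d) u≉v)

    ascent-edge : ∀ {u v} → Edge y (w ∷ʳ s) u v → u ≼ u ∷ʳ s → y ≼ v ∷ʳ s → v ≼ v ∷ʳ s → v ≺ u
    ascent-edge (edge p p' (inj₁ ((v≼u , v≉u , _) , _))) a yv a' = v≼u , v≉u
    ascent-edge (edge p p' (inj₂ ((u≼v , u≉v , _) , m))) a yv a' =
      ⊥-elim (≼-antisym u≼v (≼-trans a' (≈⇒≼ (∷ʳ-swap (A-matched m (≼-trans p a) yv)))) u≉v)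

    B-closed* : ∀ {u v} → Walk y (w ∷ʳ s) u v → ¬ (y ≼ u ∷ʳ s) → ¬ (y ≼ v ∷ʳ s)
    B-closed* (single e) n = B-closed e n
    B-closed* (e ∷ es) n = B-closed* es (B-closed e n)

    A-before : ∀ {u v} → Walk y (w ∷ʳ s) u v → y ≼ v ∷ʳ s → y ≼ u ∷ʳ s
    A-before es h = ≼-stable λ k → B-closed* es k h

    B-walk : ∀ {u v} → Walk y (w ∷ʳ s) u v → ¬ (y ≼ u ∷ʳ s) → Walk (y ∷ʳ s) w (u ∷ʳ s) (v ∷ʳ s)
    B-walk (single e) n = single (B-edge e n)
    B-walk (e ∷ es) n = B-edge e n ∷ B-walk es (B-closed e n)

    descent-walk : ∀ {u v} → Walk y (w ∷ʳ s) u v → u ∷ʳ s ≼ u → y ≼ v ∷ʳ s → (v ∷ʳ s ≼ v) × (v ≺ u)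
    descent-walk es@(single e) d yv = descent-edge e d (A-before es yv) yv
    descent-walk es'@(e ∷ es) d yv with descent-edge e d (A-before es' yv) (A-before es yv)
    ... | d' , x≺u with descent-walk es d' yv
    ... | d'' , v≺x = d'' , ≺-trans v≺x x≺u

    -- By `descent-walk`, a vertex with descent s would pass this descent on to the endpoint v. So
    -- no upward arrow x → xs can occur on the way.
    ascent-walk : ∀ {u v} → Walk y (w ∷ʳ s) u v → u ≼ u ∷ʳ s → y ≼ v ∷ʳ s → v ≼ v ∷ʳ s → v ≺ u
    ascent-walk (single e) a yv a' = ascent-edge e a yv a'
    ascent-walk {v = v} (_∷_ {y = x} e es) a yv a' = ≺-stable λ k → ∷ʳ-dichotomy x s λ
      { (inj₁ d) → ≼-antisym (proj₁ (descent-walk es d yv)) a' (∷ʳ-≉ v s)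
      ; (inj₂ b) → k (≺-trans (ascent-walk es b yv a') (ascent-edge e a (A-before es yv) b)) }

  acyclic : ∀ {w} → Reverse w → IsReduced w → ∀ {y u v} → Walk y w u v → ¬ u ≈ v
  acyclic [] red es e = proj₂ (descends es) (≈sym e)
    where
    untoggled : ∀ {y u v} → ¬ Toggle y [] u v
    untoggled (toggle [] _ _ _ _ () _ _ _ _ _ _)
    untoggled (toggle (_ ∷ _) _ _ _ _ () _ _ _ _ _ _)
    edge-descends : ∀ {y u v} → Edge y [] u v → v ≺ u
    edge-descends (edge _ _ (inj₁ ((p , n , _) , _)))  = p , n
    edge-descends (edge _ _ (inj₂ (_ , inj₁ m))) = ⊥-elim (untoggled m)
    edge-descends (edge _ _ (inj₂ (_ , inj₂ m))) = ⊥-elim (untoggled m)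
    descends : ∀ {y u v} → Walk y [] u v → v ≺ u
    descends (single e) = edge-descends e
    descends (e ∷ es) = ≺-trans (descends es) (edge-descends e)
  acyclic (w ∶ rs ∶ʳ s) red {y} {u} {v} es e = em (y ≼ u ∷ʳ s) λ
    { (inj₂ n) → acyclic rs (reduced-prefix w red) (B-walk es n) (++-congʳ [ s ] e)
    ; (inj₁ h) → ∷ʳ-dichotomy u s λ
      { (inj₁ d) → proj₂ (proj₂ (descent-walk es d (resp h))) (≈sym e)
      ; (inj₂ a) → proj₂ (ascent-walk es a (resp h) (≼-resp e (++-congʳ [ s ] e) a)) (≈sym e) } }
    where
    open LastLetter red
    resp : y ≼ u ∷ʳ s → y ≼ v ∷ʳ s
    resp = ≼-resp ≈refl (++-congʳ [ s ] e)

  -- Masks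

  length-∷ʳ-cong : ∀ (xs : List A) (ys : List B) {x y} → length xs ≡ length ys → length (xs ∷ʳ x) ≡ length (ys ∷ʳ y)
  length-∷ʳ-cong []       []       e = refl
  length-∷ʳ-cong (_ ∷ xs) (_ ∷ ys) e = cong suc (length-∷ʳ-cong xs ys (suc-injective e))

  ++-injective : ∀ (a : List A) {b c d} → length a ≡ length c → a ++ b ≡ c ++ d → a ≡ c × b ≡ d
  ++-injective []      {c = []}    _ e = refl , e
  ++-injective (x ∷ a) {c = y ∷ c} l e with ∷-injective e
  ... | refl , e' with ++-injective a {c = c} (suc-injective l) e'
  ... | refl , e'' = refl , e''

  ++-longer : ∀ (a : List A) {x b} c {y d} → a ++ x ∷ b ≡ c ++ y ∷ d → length a < length c →
              ∃[ e ] (c ≡ a ++ x ∷ e × b ≡ e ++ y ∷ d)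
  ++-longer []      (z ∷ c) e _ with ∷-injective e
  ... | refl , e' = c , refl , e'
  ++-longer (x ∷ a) (z ∷ c) e (s≤s l) with ∷-injective e
  ... | refl , e' with ++-longer a c e' l
  ... | f , refl , e'' = f , refl , e''

  ∷ʳ-split : ∀ (a : List A) {x} b {y c} → a ∷ʳ x ≡ b ++ y ∷ c → length b < length a →
             ∃[ c' ] (a ≡ b ++ y ∷ c')
  ∷ʳ-split (z ∷ a) []      e _ with ∷-injective e
  ... | refl , _ = a , refl
  ∷ʳ-split (z ∷ a) (w ∷ b) e (s≤s l) with ∷-injective e
  ... | refl , e' with ∷ʳ-split a b e' l
  ... | c' , refl = c' , refl

  ∷ʳ-split-length : ∀ (a : List A) {x} b {y c} → a ∷ʳ x ≡ b ++ y ∷ c → length b < length a ⊎ (a ≡ b × x ≡ y)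
  ∷ʳ-split-length []      []      refl = inj₂ (refl , refl)
  ∷ʳ-split-length []      (_ ∷ []) ()
  ∷ʳ-split-length []      (_ ∷ _ ∷ _) ()
  ∷ʳ-split-length (z ∷ a) []      e = inj₁ (s≤s z≤n)
  ∷ʳ-split-length (z ∷ a) (w ∷ b) e with ∷-injective e
  ... | refl , e' with ∷ʳ-split-length a b e'
  ... | inj₁ l = inj₁ (s≤s l)
  ... | inj₂ (refl , refl) = inj₂ (refl , refl)

  selB-++ : ∀ β₁ w₁ {β₂ w₂} → length β₁ ≡ length w₁ → selB (β₁ ++ β₂) (w₁ ++ w₂) ≡ selB β₁ w₁ ++ selB β₂ w₂
  selB-++ []          []       e = refl
  selB-++ (true ∷ β)  (s ∷ w)  e = cong (s ∷_) (selB-++ β w (suc-injective e))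
  selB-++ (false ∷ β) (s ∷ w)  e = selB-++ β w (suc-injective e)

  sel1-++ : ∀ σ₁ w₁ {σ₂ w₂} → length σ₁ ≡ length w₁ → sel1 (σ₁ ++ σ₂) (w₁ ++ w₂) ≡ sel1 σ₁ w₁ ++ sel1 σ₂ w₂
  sel1-++ []      []       e = refl
  sel1-++ (𝟏 ∷ σ) (s ∷ w)  e = cong (s ∷_) (sel1-++ σ w (suc-injective e))
  sel1-++ (𝟎 ∷ σ) (s ∷ w)  e = sel1-++ σ w (suc-injective e)
  sel1-++ (𝐗 ∷ σ) (s ∷ w)  e = sel1-++ σ w (suc-injective e)

  Ξ-++ : ∀ σ₁ {σ₂} → Ξ (σ₁ ++ σ₂) ≡ Ξ σ₁ ++ Ξ σ₂
  Ξ-++ []      = refl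
  Ξ-++ (𝟎 ∷ σ) = cong (true ∷_) (Ξ-++ σ)
  Ξ-++ (𝟏 ∷ σ) = cong (true ∷_) (Ξ-++ σ)
  Ξ-++ (𝐗 ∷ σ) = cong (false ∷_) (Ξ-++ σ)

  ν-++ : ∀ σ₁ {σ₂} → ν (σ₁ ++ σ₂) ≡ ν σ₁ ++ ν σ₂
  ν-++ []      = refl
  ν-++ (𝟎 ∷ σ) = cong (false ∷_) (ν-++ σ)
  ν-++ (𝟏 ∷ σ) = cong (true ∷_) (ν-++ σ)
  ν-++ (𝐗 ∷ σ) = ν-++ σ

  length-Ξ : ∀ σ → length (Ξ σ) ≡ length σ
  length-Ξ []      = refl
  length-Ξ (𝟎 ∷ σ) = cong suc (length-Ξ σ)
  length-Ξ (𝟏 ∷ σ) = cong suc (length-Ξ σ)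
  length-Ξ (𝐗 ∷ σ) = cong suc (length-Ξ σ)

  selΞ-++ : ∀ σ₁ w₁ {σ₂ w₂} → length σ₁ ≡ length w₁ → selΞ (σ₁ ++ σ₂) (w₁ ++ w₂) ≡ selΞ σ₁ w₁ ++ selΞ σ₂ w₂
  selΞ-++ σ₁ w₁ {σ₂} {w₂} e = trans (cong (λ β → selB β (w₁ ++ w₂)) (Ξ-++ σ₁))
    (selB-++ (Ξ σ₁) w₁ (trans (length-Ξ σ₁) e))

  sel1≡ : ∀ σ w → length σ ≡ length w → selB (ν σ) (selΞ σ w) ≡ sel1 σ w
  sel1≡ []      []      e = refl
  sel1≡ (𝟎 ∷ σ) (s ∷ w) e = sel1≡ σ w (suc-injective e)
  sel1≡ (𝟏 ∷ σ) (s ∷ w) e = cong (s ∷_) (sel1≡ σ w (suc-injective e))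
  sel1≡ (𝐗 ∷ σ) (s ∷ w) e = sel1≡ σ w (suc-injective e)

  sel1⊆selΞ : ∀ σ w → sel1 σ w ⊆ selΞ σ w
  sel1⊆selΞ []      w       = []
  sel1⊆selΞ (𝟎 ∷ σ) []      = []
  sel1⊆selΞ (𝟏 ∷ σ) []      = []
  sel1⊆selΞ (𝐗 ∷ σ) []      = []
  sel1⊆selΞ (𝟎 ∷ σ) (s ∷ w) = skip s (sel1⊆selΞ σ w)
  sel1⊆selΞ (𝟏 ∷ σ) (s ∷ w) = refl ∷ sel1⊆selΞ σ w
  sel1⊆selΞ (𝐗 ∷ σ) (s ∷ w) = sel1⊆selΞ σ w

  -- This is why cases (3) and (4) of φ change x only at the chosen position, whatever ρ is.
  Ξ-repl : ∀ σ ρ → Ξ (repl σ ρ) ≡ Ξ σ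
  Ξ-repl []      ρ           = refl
  Ξ-repl (𝐗 ∷ σ) ρ           = cong (false ∷_) (Ξ-repl σ ρ)
  Ξ-repl (𝟎 ∷ σ) []          = refl
  Ξ-repl (𝟎 ∷ σ) (true ∷ ρ)  = cong (true ∷_) (Ξ-repl σ ρ)
  Ξ-repl (𝟎 ∷ σ) (false ∷ ρ) = cong (true ∷_) (Ξ-repl σ ρ)
  Ξ-repl (𝟏 ∷ σ) []          = refl
  Ξ-repl (𝟏 ∷ σ) (true ∷ ρ)  = cong (true ∷_) (Ξ-repl σ ρ)
  Ξ-repl (𝟏 ∷ σ) (false ∷ ρ) = cong (true ∷_) (Ξ-repl σ ρ)

  descent⇒<B : ∀ {x s} → x ∷ʳ s ≼ x → ¬ ¬ (x ∷ʳ s <B x)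
  descent⇒<B {x} {s} d k = ≼⇒≤B d λ b → k (b , ∷ʳ-≉ x s)

  <B⇒descent : ∀ {x s} → x ∷ʳ s <B x → x ∷ʳ s ≼ x
  <B⇒descent (b , _) = ≤B⇒≼ b

  nodefect⇒ascent : ∀ {x s} → ¬ (x ∷ʳ s <B x) → x ≼ x ∷ʳ s
  nodefect⇒ascent {x} {s} n = ≼-stable λ k → ∷ʳ-dichotomy x s λ
    { (inj₁ d) → descent⇒<B d n ; (inj₂ a) → k a }

  ascent⇒nodefect : ∀ {x s} → x ≼ x ∷ʳ s → ¬ (x ∷ʳ s <B x)
  ascent⇒nodefect {x} {s} a d = ≼-antisym a (<B⇒descent d) λ e → ∷ʳ-≉ x s (≈sym e)

  IsReduced-stable : ∀ {r} → ¬ ¬ IsReduced r → IsReduced r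
  IsReduced-stable h r' e = ≮⇒≥ λ l → h λ red → <-irrefl refl (≤-trans l (red r' e))

  -- A reduced word for rs contains a subword for r. Were it no longer than r, that subword would be
  -- all of it, giving r = rs.
  reduced-∷ʳ : ∀ {r s} → IsReduced r → r ≼ r ∷ʳ s → IsReduced (r ∷ʳ s)
  reduced-∷ʳ {r} {s} red a = IsReduced-stable λ k → reduced-exists (r ∷ʳ s) λ { (q , redq , e) →
    subword a q e λ { (p , sub , f) →
    k (minimal⇒reduced redq (≈sym e) (≤-trans (≤-reflexive (trans (length-++ r) (+-comm (length r) 1)))
      (≰⇒> λ le → ∷ʳ-≉ r s (≈trans (≈sym e)
        (≈trans (≡⇒≈ (sym (⊆-full sub (≤-trans le (red p f))))) f))))) } }

  NoDefectB-prefix : ∀ {β w} β' w' → NoDefectB (β ++ β') (w ++ w') → NoDefectB β w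
  NoDefectB-prefix β' w' nd w₁ s w₂ β₁ b β₂ refl refl =
    nd w₁ s (w₂ ++ w') β₁ b (β₂ ++ β') (++-assoc w₁ (s ∷ w₂) w') (++-assoc β₁ (b ∷ β₂) β')

  -- Without defects every selected letter is an ascent of the product so far. The prefix is an
  -- accumulator because `NoDefectB` speaks of splittings of the whole word.
  NoDefectB⇒reduced : ∀ β w → length β ≡ length w → NoDefectB β w → IsReduced (selB β w)
  NoDefectB⇒reduced β w = go [] [] refl (λ _ _ → z≤n) β w
    where
    go : ∀ β₁ w₁ → length β₁ ≡ length w₁ → IsReduced (selB β₁ w₁) → ∀ β₂ w₂ → length β₂ ≡ length w₂ →
         NoDefectB (β₁ ++ β₂) (w₁ ++ w₂) → IsReduced (selB (β₁ ++ β₂) (w₁ ++ w₂))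
    go β₁ w₁ e red [] [] _ nd = subst₂ (λ β w → IsReduced (selB β w))
      (sym (++-identityʳ β₁)) (sym (++-identityʳ w₁)) red
    go β₁ w₁ e red (b ∷ β₂) (s ∷ w₂) e₂ nd =
      subst₂ (λ β w → IsReduced (selB β w)) (∷ʳ-++ β₁ b β₂) (∷ʳ-++ w₁ s w₂)
        (go (β₁ ∷ʳ b) (w₁ ∷ʳ s) (length-∷ʳ-cong β₁ w₁ e) (subst IsReduced (sym (selB-++ β₁ w₁ e)) (red' b))
            β₂ w₂ (suc-injective e₂)
            (subst₂ NoDefectB (sym (∷ʳ-++ β₁ b β₂)) (sym (∷ʳ-++ w₁ s w₂)) nd))
      where
      red' : ∀ b → IsReduced (selB β₁ w₁ ++ selB [ b ] [ s ])
      red' true  = reduced-∷ʳ red (nodefect⇒ascent (nd w₁ s w₂ β₁ b β₂ refl refl e))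
      red' false = subst IsReduced (sym (++-identityʳ _)) red

  NoDefectB-∷ʳ : ∀ {β w b s} → length β ≡ length w → NoDefectB β w → selB β w ≼ selB β w ∷ʳ s →
                 NoDefectB (β ∷ʳ b) (w ∷ʳ s)
  NoDefectB-∷ʳ {β} {w} e nd a w₁ s w₂ β₁ b β₂ w≡ β≡ e₁ with ∷ʳ-split-length w w₁ w≡
  ... | inj₂ (refl , refl) with ++-injective β {c = β₁} (trans e (sym e₁)) β≡
  ...   | refl , _ = ascent⇒nodefect a
  NoDefectB-∷ʳ {β} {w} e nd a w₁ s w₂ β₁ b β₂ w≡ β≡ e₁ | inj₁ l
    with ∷ʳ-split w w₁ w≡ l | ∷ʳ-split β β₁ β≡ (subst₂ _<_ (sym e₁) (sym e) l)
  ... | w₂' , w≡' | β₂' , β≡' = nd w₁ s w₂' β₁ b β₂' w≡' β≡' e₁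

  ConstMask-∷ʳ : ∀ {w β u s} b → ConstMask w β u → u ≼ u ∷ʳ s →
                 ConstMask (w ∷ʳ s) (β ∷ʳ b) (u ++ selB [ b ] [ s ])
  ConstMask-∷ʳ {w} {β} {s = s} b (l , nd , e) a = length-∷ʳ-cong β w l ,
    NoDefectB-∷ʳ l nd (≼-resp (≈sym e) (++-congʳ [ s ] (≈sym e)) a) ,
    ≈trans (≡⇒≈ (selB-++ β w l)) (++-congʳ _ e)

  ConstMask-resp : ∀ {w β u v} → u ≈ v → ConstMask w β u → ConstMask w β v
  ConstMask-resp e (l , nd , f) = l , nd , ≈trans f e

  invol-ascent : ∀ {x s} → x ∷ʳ s ≼ x → x ∷ʳ s ≼ (x ∷ʳ s) ∷ʳ s
  invol-ascent {x} {s} d = ≼-resp ≈refl (≈sym (involʳ x s)) d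

  reduced-ascent : ∀ {w s} → IsReduced (w ∷ʳ s) → w ≼ w ∷ʳ s
  reduced-ascent {w} {s} red = ⊆⇒≼ red (subst (_⊆ w ∷ʳ s) (++-identityʳ w) (++⁺ (⊆-refl {x = w}) (minimum [ s ])))

  ≼-init : ∀ {u w s} → IsReduced (w ∷ʳ s) → u ≼ w ∷ʳ s → u ≼ u ∷ʳ s → u ≼ w
  ≼-init {w = w} {s} red p a = ≼-resp ≈refl (involʳ w s) (lift₂ p (invol-≼ (reduced-ascent red)) a)

  ≼-init' : ∀ {u w s} → IsReduced (w ∷ʳ s) → u ≼ w ∷ʳ s → u ∷ʳ s ≼ u → u ∷ʳ s ≼ w
  ≼-init' {w = w} {s} red p d = ≼-resp ≈refl (involʳ w s) (lift₃ p (invol-≼ (reduced-ascent red)) d)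

  ≼[] : ∀ {u} → u ≼ [] → ¬ ¬ (u ≈ [])
  ≼[] p k = subword p [] ≈refl λ { ([] , [] , e) → k (≈sym e) }

  -- Deodhar's construction from the right: the last entry is 1 exactly when s is a descent of u,
  -- and lifting places what remains below the shorter word.
  ConstMask-exists : ∀ {w} → Reverse w → IsReduced w → ∀ {u} → u ≼ w → ¬ ¬ (∃[ β ] ConstMask w β u)
  ConstMask-exists [] red p k = ≼[] p λ e → k ([] , refl , (λ { [] _ _ _ _ _ () ; (_ ∷ _) _ _ _ _ _ () }) , ≈sym e)
  ConstMask-exists (w ∶ rs ∶ʳ s) red {u} p k = ∷ʳ-dichotomy u s λ
    { (inj₁ d) → ConstMask-exists rs (reduced-prefix w red) (≼-init' red p d) λ { (β , cm) →
        k (β ∷ʳ true , ConstMask-resp (involʳ u s) (ConstMask-∷ʳ true cm (invol-ascent d))) }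
    ; (inj₂ a) → ConstMask-exists rs (reduced-prefix w red) (≼-init red p a) λ { (β , cm) →
        k (β ∷ʳ false , ConstMask-resp (≡⇒≈ (++-identityʳ u)) (ConstMask-∷ʳ false cm a)) } }

  -- RelMask without its order conditions, and with x up to ≈.
  MaskFor : Word → Word → List Tri → Word → Set
  MaskFor y w σ u = length σ ≡ length w × ConstMask w (Ξ σ) u × ConstMask (selΞ σ w) (ν σ) y

  MaskFor-resp : ∀ {y y' w σ u u'} → y ≈ y' → u ≈ u' → MaskFor y w σ u → MaskFor y' w σ u'
  MaskFor-resp e f (l , cm , cm') = l , ConstMask-resp f cm , ConstMask-resp e cm'

  MaskFor-𝐗 : ∀ {y w σ u s} → u ≼ u ∷ʳ s → MaskFor y w σ u → MaskFor y (w ∷ʳ s) (σ ∷ʳ 𝐗) u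
  MaskFor-𝐗 {w = w} {σ} {u} {s} a (l , cm , cm') = length-∷ʳ-cong σ w l ,
    subst (λ β → ConstMask (w ∷ʳ s) β u) (sym (Ξ-++ σ)) (ConstMask-resp (≡⇒≈ (++-identityʳ u)) (ConstMask-∷ʳ false cm a)) ,
    subst₂ (λ r β → ConstMask r β _) (sym (trans (selΞ-++ σ w l) (++-identityʳ _)))
      (sym (trans (ν-++ σ) (++-identityʳ (ν σ)))) cm'

  MaskFor-𝟎 : ∀ {y w σ u s} → u ≼ u ∷ʳ s → y ≼ y ∷ʳ s → MaskFor y w σ u → MaskFor y (w ∷ʳ s) (σ ∷ʳ 𝟎) (u ∷ʳ s)
  MaskFor-𝟎 {y} {w} {σ} {u} {s} a a' (l , cm , cm') = length-∷ʳ-cong σ w l ,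
    subst (λ β → ConstMask (w ∷ʳ s) β (u ∷ʳ s)) (sym (Ξ-++ σ)) (ConstMask-∷ʳ true cm a) ,
    subst₂ (λ r β → ConstMask r β y) (sym (selΞ-++ σ w l)) (sym (ν-++ σ))
      (ConstMask-resp (≡⇒≈ (++-identityʳ y)) (ConstMask-∷ʳ false cm' a'))

  MaskFor-𝟏 : ∀ {y w σ u s} → u ≼ u ∷ʳ s → y ≼ y ∷ʳ s → MaskFor y w σ u → MaskFor (y ∷ʳ s) (w ∷ʳ s) (σ ∷ʳ 𝟏) (u ∷ʳ s)
  MaskFor-𝟏 {y} {w} {σ} {u} {s} a a' (l , cm , cm') = length-∷ʳ-cong σ w l ,
    subst (λ β → ConstMask (w ∷ʳ s) β (u ∷ʳ s)) (sym (Ξ-++ σ)) (ConstMask-∷ʳ true cm a) ,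
    subst₂ (λ r β → ConstMask r β (y ∷ʳ s)) (sym (selΞ-++ σ w l)) (sym (ν-++ σ)) (ConstMask-∷ʳ true cm' a')

  -- The last entry is dictated by s: 𝐗 if it is an ascent of u, 𝟎 if it is a descent of u but not
  -- of y, 𝟏 if it is a descent of both.
  MaskFor-exists : ∀ {w} → Reverse w → IsReduced w → ∀ {y u} → y ≼ u → u ≼ w → ¬ ¬ (∃[ σ ] MaskFor y w σ u)
  MaskFor-exists [] red p p' k = ≼[] p' λ e → ≼[] (≼-trans p (≈⇒≼ e)) λ e' →
    k ([] , refl , (refl , nd , ≈sym e) , (refl , nd , ≈sym e'))
    where
    nd : NoDefectB [] []
    nd []      _ _ _ _ _ ()
    nd (_ ∷ _) _ _ _ _ _ ()
  MaskFor-exists (w ∶ rs ∶ʳ s) red {y} {u} p p' k = ∷ʳ-dichotomy u s λ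
    { (inj₂ a) → MaskFor-exists rs red' p (≼-init red p' a) λ { (σ , m) → k (σ ∷ʳ 𝐗 , MaskFor-𝐗 a m) }
    ; (inj₁ d) → ∷ʳ-dichotomy y s λ
      { (inj₂ a) → MaskFor-exists rs red' (lift₂ p d a) (≼-init' red p' d) λ { (σ , m) →
          k (σ ∷ʳ 𝟎 , MaskFor-resp ≈refl (involʳ u s) (MaskFor-𝟎 (invol-ascent d) a m)) }
      ; (inj₁ d') → MaskFor-exists rs red' (lift₃ p d d') (≼-init' red p' d) λ { (σ , m) →
          k (σ ∷ʳ 𝟏 , MaskFor-resp (involʳ y s) (involʳ u s) (MaskFor-𝟏 (invol-ascent d) (invol-ascent d') m)) } } }
    where
    red' = reduced-prefix w red

  -- Translation between the map φ and toggles

  ones : Word → List Tri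
  ones = map (λ _ → 𝟏)

  sel1-ones : ∀ q → sel1 (ones q) q ≡ q
  sel1-ones []      = refl
  sel1-ones (s ∷ q) = cong (s ∷_) (sel1-ones q)

  selΞ-ones : ∀ q → selΞ (ones q) q ≡ q
  selΞ-ones []      = refl
  selΞ-ones (s ∷ q) = cong (s ∷_) (selΞ-ones q)

  length-∷ʳ-≤ : ∀ (xs : List S) {x} n → n ≤ length xs → n ≤ length (xs ∷ʳ x)
  length-∷ʳ-≤ xs n le = ≤-trans le (subst (length xs ≤_) (sym (length-++ xs)) (m≤m+n _ 1))

  -- Every 𝟎 meets (2), and an 𝐗 cannot fail both (1) and (3), since these are complementary. What
  -- remains is 𝟏 without a shifted descent.
  NoCondRightOf⇒ones : ∀ {j} w₁ σ₁ w₂ σ₂ → length σ₁ ≡ length w₁ → length σ₂ ≡ length w₂ → j < length w₁ →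
                       NoCondRightOf (w₁ ++ w₂) (σ₁ ++ σ₂) j →
                       σ₂ ≡ ones w₂ × NSD (sel1 σ₁ w₁) (selΞ σ₁ w₁) w₂
  NoCondRightOf⇒ones w₁ σ₁ []      []      l₁ l₂ j< nc = refl , tt
  NoCondRightOf⇒ones w₁ σ₁ (s ∷ w) (𝟎 ∷ σ) l₁ l₂ j< nc = ⊥-elim (nc w₁ s w σ₁ 𝟎 σ refl refl l₁ j< tt)
  NoCondRightOf⇒ones w₁ σ₁ (s ∷ w) (𝐗 ∷ σ) l₁ l₂ j< nc = ⊥-elim (h (inj₁ λ d → h (inj₂ d)))
    where h = nc w₁ s w σ₁ 𝐗 σ refl refl l₁ j<
  NoCondRightOf⇒ones {j} w₁ σ₁ (s ∷ w) (𝟏 ∷ σ) l₁ l₂ j< nc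
    with NoCondRightOf⇒ones {j} (w₁ ∷ʳ s) (σ₁ ∷ʳ 𝟏) w σ (length-∷ʳ-cong σ₁ w₁ l₁) (suc-injective l₂)
           (length-∷ʳ-≤ w₁ _ j<)
           (subst₂ (λ w σ → NoCondRightOf w σ j) (sym (∷ʳ-++ w₁ s w)) (sym (∷ʳ-++ σ₁ 𝟏 σ)) nc)
  ... | e , n = cong (𝟏 ∷_) e ,
    (λ p → ≼⇒≤B p (nc w₁ s w σ₁ 𝟏 σ refl refl l₁ j<)) ,
    subst₂ (λ y x → NSD y x w) (sel1-++ σ₁ w₁ l₁) (selΞ-++ σ₁ w₁ l₁) n

  tail-length : ∀ (a : List A) (a' : List B) {x y b b'} → length a ≡ length a' →
                length (a ++ x ∷ b) ≡ length (a' ++ y ∷ b') → length b ≡ length b'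
  tail-length []      []       _ e = suc-injective e
  tail-length (_ ∷ a) (_ ∷ a') l e = tail-length a a' (suc-injective l) (suc-injective e)

  -- The common part of the four cases of φ: position j carries the letter s and the entry d,
  -- and everything to its right is unshifted.
  module AtPosition {y w₁ : Word} {s : S} {w₂ : Word} {σ₁ : List Tri} {d : Tri} {σ₂ : List Tri} (l₁ : length σ₁ ≡ length w₁)
    (rm : RelMask y (w₁ ++ s ∷ w₂) (σ₁ ++ d ∷ σ₂))
    (nc : NoCondRightOf (w₁ ++ s ∷ w₂) (σ₁ ++ d ∷ σ₂) (length w₁)) where

    Y X Yd Xd : Word
    Y  = sel1 σ₁ w₁
    X  = selΞ σ₁ w₁
    Yd = Y ++ sel1 [ d ] [ s ]
    Xd = X ++ selΞ [ d ] [ s ]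

    private
      l = proj₁ rm
      l₂ : length σ₂ ≡ length w₂
      l₂ = tail-length σ₁ w₁ l₁ l
      l₁' = length-∷ʳ-cong σ₁ w₁ {d} {s} l₁

      tail : σ₂ ≡ ones w₂ × NSD (sel1 (σ₁ ∷ʳ d) (w₁ ∷ʳ s)) (selΞ (σ₁ ∷ʳ d) (w₁ ∷ʳ s)) w₂
      -- The scan starts one place after the chosen position, where the prefix has length one more
      -- than w₁, so the strict bound holds.
      tail = NoCondRightOf⇒ones (w₁ ∷ʳ s) (σ₁ ∷ʳ d) w₂ σ₂ l₁' l₂
        (≤-reflexive (trans (+-comm 1 _) (sym (length-++ w₁))))
        (subst₂ (λ w σ → NoCondRightOf w σ (length w₁)) (sym (∷ʳ-++ w₁ s w₂)) (sym (∷ʳ-++ σ₁ d σ₂)) nc)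

    σ₂-ones : σ₂ ≡ ones w₂
    σ₂-ones = proj₁ tail

    nsd : NSD Yd Xd w₂
    nsd = subst₂ (λ y x → NSD y x w₂) (sel1-++ σ₁ w₁ l₁) (selΞ-++ σ₁ w₁ l₁) (proj₂ tail)

    selΞ-at : ∀ σ e → Ξ σ ≡ Ξ σ₁ → selΞ (σ ++ e ∷ σ₂) (w₁ ++ s ∷ w₂) ≡ (X ++ selΞ [ e ] [ s ]) ++ w₂
    selΞ-at σ e eq = trans (selΞ-++ σ w₁ (trans (sym (length-Ξ σ)) (trans (cong length eq) (trans (length-Ξ σ₁) l₁))))
      (trans (cong₂ _++_ (cong (λ β → selB β w₁) eq) (head e)) (sym (++-assoc X _ w₂)))
      where
      head : ∀ e → selΞ (e ∷ σ₂) (s ∷ w₂) ≡ selΞ [ e ] [ s ] ++ w₂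
      head 𝟎 = cong (s ∷_) (trans (cong (λ σ → selΞ σ w₂) σ₂-ones) (selΞ-ones w₂))
      head 𝟏 = cong (s ∷_) (trans (cong (λ σ → selΞ σ w₂) σ₂-ones) (selΞ-ones w₂))
      head 𝐗 = trans (cong (λ σ → selΞ σ w₂) σ₂-ones) (selΞ-ones w₂)

    u≡ : selΞ (σ₁ ++ d ∷ σ₂) (w₁ ++ s ∷ w₂) ≡ Xd ++ w₂
    u≡ = selΞ-at σ₁ d refl

    y≈ : y ≈ Yd ++ w₂
    y≈ = ≈trans (≈sym (proj₂ (proj₂ (proj₁ (proj₂ (proj₂ rm))))))
      (≡⇒≈ (trans (sel1≡ (σ₁ ++ d ∷ σ₂) (w₁ ++ s ∷ w₂) l)
      (trans (sel1-++ σ₁ w₁ l₁) (trans (cong (Y ++_) (head d)) (sym (++-assoc Y _ w₂))))))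
      where
      head : ∀ e → sel1 (e ∷ σ₂) (s ∷ w₂) ≡ sel1 [ e ] [ s ] ++ w₂
      head 𝟎 = trans (cong (λ σ → sel1 σ w₂) σ₂-ones) (sel1-ones w₂)
      head 𝟏 = cong (s ∷_) (trans (cong (λ σ → sel1 σ w₂) σ₂-ones) (sel1-ones w₂))
      head 𝐗 = trans (cong (λ σ → sel1 σ w₂) σ₂-ones) (sel1-ones w₂)

    private
      nd : NoDefectB (Ξ σ₁ ++ Ξ (d ∷ σ₂)) (w₁ ++ s ∷ w₂)
      nd = subst (λ β → NoDefectB β (w₁ ++ s ∷ w₂)) (Ξ-++ σ₁) (proj₁ (proj₂ (proj₁ (proj₂ rm))))

    Y≼X : Y ≼ X
    Y≼X = ⊆⇒≼ (NoDefectB⇒reduced (Ξ σ₁) w₁ (trans (length-Ξ σ₁) l₁) (NoDefectB-prefix _ (s ∷ w₂) nd)) (sel1⊆selΞ σ₁ w₁)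

    X≼Xs : X ≼ X ∷ʳ s
    X≼Xs = nodefect⇒ascent (at d)
      where
      at : ∀ e → ¬ (X ∷ʳ s <B X)
      -- `Ξ` is stuck on the unknown entry `d`; abstracting it together with its length leaves only
      -- the nonempty list.
      at _ with Ξ (d ∷ σ₂) | length-Ξ (d ∷ σ₂) | nd
      ... | b ∷ β | _ | nd = nd w₁ s w₂ (Ξ σ₁) b β refl refl (trans (length-Ξ σ₁) l₁)

  ≈[] : ∀ (x : Word) q → (x ++ []) ++ q ≈ x ++ q
  ≈[] x q = ≡⇒≈ (cong (_++ q) (++-identityʳ x))

  -- For an 𝐗 the element x₀ is the prefix product X, otherwise it is Xs, which the toggle takes
  -- back to X. Only for a 𝟏 does y₀ include the letter s, and then the shifted descent is the
  -- condition y₀ ≤ x₀s.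
  MPair⇒Toggle : ∀ {y w u v} → MPair y w u v → Toggle y w u v
  MPair⇒Toggle (_ , _ , rm , case1 w₁ s w₂ σ₁ σ₂ refl refl l nc _ , u≈ , v≈) =
    toggle w₁ s w₂ Y X refl (≈trans y≈ (≈[] Y w₂)) (≈trans (≈sym u≈) (≈trans (≡⇒≈ u≡) (≈[] X w₂)))
      (≈trans (≈sym v≈) (≡⇒≈ (selΞ-at σ₁ 𝟎 refl))) Y≼X (≼-trans Y≼X X≼Xs)
      (NSD-resp w₂ (≡⇒≈ (++-identityʳ Y)) (≡⇒≈ (++-identityʳ X)) nsd)
    where open AtPosition l rm nc
  MPair⇒Toggle (_ , _ , rm , case2 w₁ s w₂ σ₁ σ₂ refl refl l nc , u≈ , v≈) =
    toggle w₁ s w₂ Y (X ∷ʳ s) refl (≈trans y≈ (≈[] Y w₂)) (≈trans (≈sym u≈) (≡⇒≈ u≡))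
      (≈trans (≈sym v≈) (≈trans (≡⇒≈ (selΞ-at σ₁ 𝐗 refl)) (≈trans (≈[] X w₂) (++-congʳ w₂ (≈sym (involʳ X s))))))
      (≼-trans Y≼X X≼Xs) (≼-resp ≈refl (≈sym (involʳ X s)) Y≼X)
      (NSD-resp w₂ (≡⇒≈ (++-identityʳ Y)) ≈refl nsd)
    where open AtPosition l rm nc
  MPair⇒Toggle (_ , _ , rm , case3 w₁ s w₂ σ₁ σ₂ refl refl l nc _ ρ _ , u≈ , v≈) =
    toggle w₁ s w₂ Y X refl (≈trans y≈ (≈[] Y w₂)) (≈trans (≈sym u≈) (≈trans (≡⇒≈ u≡) (≈[] X w₂)))
      (≈trans (≈sym v≈) (≡⇒≈ (selΞ-at (repl σ₁ ρ) 𝟏 (Ξ-repl σ₁ ρ)))) Y≼X (≼-trans Y≼X X≼Xs)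
      (NSD-resp w₂ (≡⇒≈ (++-identityʳ Y)) (≡⇒≈ (++-identityʳ X)) nsd)
    where open AtPosition l rm nc
  MPair⇒Toggle (_ , _ , rm , case4 w₁ s w₂ σ₁ σ₂ refl refl l nc Ys≤X ρ _ , u≈ , v≈) =
    toggle w₁ s w₂ (Y ∷ʳ s) (X ∷ʳ s) refl y≈ (≈trans (≈sym u≈) (≡⇒≈ u≡))
      (≈trans (≈sym v≈) (≈trans (≡⇒≈ (selΞ-at (repl σ₁ ρ) 𝐗 (Ξ-repl σ₁ ρ)))
        (≈trans (≈[] X w₂) (++-congʳ w₂ (≈sym (involʳ X s))))))
      (lift₄ Y≼X X≼Xs) (≼-resp ≈refl (≈sym (involʳ X s)) (≤B⇒≼ Ys≤X)) nsd
    where open AtPosition l rm nc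

  MaskFor-ones : ∀ {y w σ x} q → y ≼ x → NSD y x q → MaskFor y w σ x →
                 MaskFor (y ++ q) (w ++ q) (σ ++ ones q) (x ++ q)
  MaskFor-ones {y} {w} {σ} {x} [] p n m =
    subst₂ (λ w σ → MaskFor (y ++ []) w σ (x ++ [])) (sym (++-identityʳ w)) (sym (++-identityʳ σ))
      (MaskFor-resp (≡⇒≈ (sym (++-identityʳ y))) (≡⇒≈ (sym (++-identityʳ x))) m)
  MaskFor-ones {y} {w} {σ} {x} (b ∷ q) p (n , ns) m =
    subst₂ (λ w σ → MaskFor (y ++ b ∷ q) w σ (x ++ b ∷ q)) (∷ʳ-++ w b q) (∷ʳ-++ σ 𝟏 (ones q))
      (MaskFor-resp (≡⇒≈ (∷ʳ-++ y b q)) (≡⇒≈ (∷ʳ-++ x b q))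
        (MaskFor-ones q (ascent-both p n) ns (MaskFor-𝟏 (ascent-upper p n) (ascent-lower p n) m)))

  -- Letters are cancelled from the right end: each is a descent of the left side because q has no
  -- shifted descents, and of the right side because wq is reduced.
  ≼-strip : ∀ {y x w} q → y ≼ x → NSD y x q → IsReduced (w ++ q) → x ++ q ≼ w ++ q → x ≼ w
  ≼-strip {y} {x} {w} [] p n red h = subst₂ _≼_ (++-identityʳ x) (++-identityʳ w) h
  ≼-strip {y} {x} {w} (b ∷ q) p (n , ns) red h =
    ≼-resp (involʳ x b) ≈refl (≼-init' (reduced-prefix (w ∷ʳ b) red')
      (≼-strip q (ascent-both p n) ns red' (subst₂ _≼_ (sym (∷ʳ-++ x b q)) (sym (∷ʳ-++ w b q)) h))
      (invol-≼ (ascent-upper p n)))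
    where
    red' : IsReduced ((w ∷ʳ b) ++ q)
    red' = subst IsReduced (sym (∷ʳ-++ w b q)) red

  -- A position further right falls into `ones q`, so its entry is 𝟏 and its condition is a shifted
  -- descent, which `NSD-at` refutes.
  NSD⇒NoCondRightOf : ∀ {w₁ c q σ₁ d y x} → length σ₁ ≡ length w₁ →
    sel1 (σ₁ ∷ʳ d) (w₁ ∷ʳ c) ≈ y → selΞ (σ₁ ∷ʳ d) (w₁ ∷ʳ c) ≈ x → NSD y x q →
    NoCondRightOf (w₁ ++ c ∷ q) (σ₁ ++ d ∷ ones q) (length w₁)
  NSD⇒NoCondRightOf {w₁} {c} {q} {σ₁} {d} {y} {x} l y≈ x≈ n w₁' s w₂' α e β w≡ σ≡ lα j< cond
    with ++-longer w₁ w₁' w≡ j< | ++-longer σ₁ α σ≡ (subst₂ _<_ (sym l) (sym lα) j<)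
  ... | a , refl , refl | α' , refl , q≡
    with ++-injective (ones a) {c = α'} (trans (length-map _ a) (sym (tail-length σ₁ w₁ l lα)))
           (trans (sym (map-++ _ a (s ∷ w₂'))) q≡)
  ... | refl , eq with ∷-injective eq
  ... | refl , _ = NSD-at a n (≼-resp
      (++-congʳ [ s ] (≈trans (≡⇒≈ (trans (cong₂ sel1 (sym (∷ʳ-++ σ₁ d (ones a))) (sym (∷ʳ-++ w₁ c a)))
        (trans (sel1-++ (σ₁ ∷ʳ d) (w₁ ∷ʳ c) l') (cong (_ ++_) (sel1-ones a))))) (++-congʳ a y≈)))
      (≈trans (≡⇒≈ (trans (cong₂ selΞ (sym (∷ʳ-++ σ₁ d (ones a))) (sym (∷ʳ-++ w₁ c a)))
        (trans (selΞ-++ (σ₁ ∷ʳ d) (w₁ ∷ʳ c) l') (cong (_ ++_) (selΞ-ones a))))) (++-congʳ a x≈))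
      (≤B⇒≼ cond))
    where
    l' : length (σ₁ ∷ʳ d) ≡ length (w₁ ∷ʳ c)
    l' = length-∷ʳ-cong σ₁ w₁ l

  MaskFor⇒RelMask : ∀ {y w σ u} → y ≼ u → u ≼ w → MaskFor y w σ u → ¬ ¬ RelMask y w σ
  MaskFor⇒RelMask p p' (l , (lΞ , nd , e) , cm) k =
    ≼⇒≤B (≼-resp ≈refl (≈sym e) p) λ b → ≼⇒≤B (≼-resp (≈sym e) ≈refl p') λ b' →
    k (l , (lΞ , nd , ≈refl) , cm , b , b')

  -- Whether c is an ascent or a descent of x₀ and of y₀ selects the case of φ. The prefix mask is
  -- then built for the elements before c, and q is filled with 𝟏.
  Toggle⇒MPair : ∀ {y w u v} → IsReduced w → y ≼ u → u ≼ w → Toggle y w u v → ¬ ¬ MPair y w u v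
  Toggle⇒MPair {y} {_} {u} {v} red p p' (toggle w₁ c q y₀ x₀ refl y≈ u≈ v≈ y₀≼ y₀≼c n) k =
    ∷ʳ-dichotomy x₀ c λ
    { (inj₂ a) → MaskFor-exists (reverseView w₁) redw₁ y₀≼ (≼-init redc x₀≼ a) λ { (σ₁ , m) →
        em (IsDefect w₁ σ₁ [ c ]) λ
        { (inj₂ nd) → finish σ₁ σ₁ 𝐗 𝟎 (MaskFor-𝐗 a m) m refl ≈refl (λ nc → case1 w₁ c q σ₁ (ones q) refl refl (proj₁ m) nc nd)
        ; (inj₁ df) → ConstMask-exists (reverseView (selΞ σ₁ w₁)) (reduced-selΞ m)
            (≼-trans (<B⇒descent df) (≼-resp (≈sym (MaskFor-sel1 m)) (≈sym (MaskFor-selΞ m)) y₀≼)) λ { (ρ , cm) →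
            finish σ₁ (repl σ₁ ρ) 𝐗 𝟏 (MaskFor-𝐗 a m) m (Ξ-repl σ₁ ρ) ≈refl
              (λ nc → case3 w₁ c q σ₁ (ones q) refl refl (proj₁ m) nc df ρ cm) } } }
    ; (inj₁ d) → ∷ʳ-dichotomy y₀ c λ
      { (inj₂ a) → MaskFor-exists (reverseView w₁) redw₁ y₀≼c (≼-init' redc x₀≼ d) λ { (σ₁ , m) →
          finish σ₁ σ₁ 𝟎 𝐗 (MaskFor-resp ≈refl (involʳ x₀ c) (MaskFor-𝟎 (invol-ascent d) a m)) m refl
            (≡⇒≈ (++-identityʳ _))
            (λ nc → case2 w₁ c q σ₁ (ones q) refl refl (proj₁ m) nc) }
      ; (inj₁ d') → MaskFor-exists (reverseView w₁) redw₁ (≼-trans d' y₀≼c) (≼-init' redc x₀≼ d) λ { (σ₁ , m) →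
          -- The prefix products are y₀c and x₀c here, so being a shifted descent means y₀ ≤ x₀c.
          ≼⇒≤B (≼-resp (≈sym (≈trans (++-congʳ [ c ] (MaskFor-sel1 m)) (involʳ y₀ c))) (≈sym (MaskFor-selΞ m)) y₀≼c) λ b →
          ConstMask-exists (reverseView (selΞ σ₁ w₁)) (reduced-selΞ m) (≤B⇒≼ b) λ { (ρ , cm) →
          finish σ₁ (repl σ₁ ρ) 𝟏 𝐗
            (MaskFor-resp (involʳ y₀ c) (involʳ x₀ c) (MaskFor-𝟏 (invol-ascent d) (invol-ascent d') m)) m (Ξ-repl σ₁ ρ)
            (≡⇒≈ (++-identityʳ _))
            (λ nc → case4 w₁ c q σ₁ (ones q) refl refl (proj₁ m) nc b ρ cm) } } } }
    where
    red' : IsReduced ((w₁ ∷ʳ c) ++ q)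
    red' = subst IsReduced (sym (∷ʳ-++ w₁ c q)) red
    redc = reduced-prefix (w₁ ∷ʳ c) red'
    redw₁ = reduced-prefix w₁ redc
    x₀≼ : x₀ ≼ w₁ ∷ʳ c
    x₀≼ = ≼-strip q y₀≼ n red' (≼-resp u≈ (≡⇒≈ (sym (∷ʳ-++ w₁ c q))) p')
    MaskFor-selΞ : ∀ {y w σ x} → MaskFor y w σ x → selΞ σ w ≈ x
    MaskFor-selΞ (_ , (_ , _ , e) , _) = e
    MaskFor-sel1 : ∀ {y w σ x} → MaskFor y w σ x → sel1 σ w ≈ y
    MaskFor-sel1 {w = w} {σ} (l , _ , (_ , _ , e)) = subst (_≈ _) (sel1≡ σ w l) e
    reduced-selΞ : ∀ {y w σ x} → MaskFor y w σ x → IsReduced (selΞ σ w)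
    reduced-selΞ {w = w} {σ} (l , (lΞ , nd , _) , _) = NoDefectB⇒reduced (Ξ σ) w lΞ nd
    selΞ-head : ∀ e → selΞ (e ∷ ones q) (c ∷ q) ≡ selΞ [ e ] [ c ] ++ q
    selΞ-head 𝟎 = cong (c ∷_) (selΞ-ones q)
    selΞ-head 𝟏 = cong (c ∷_) (selΞ-ones q)
    selΞ-head 𝐗 = selΞ-ones q
    finish : ∀ σ₁ σ₁' d d' {y₁ x₁} → MaskFor y₀ (w₁ ∷ʳ c) (σ₁ ∷ʳ d) x₀ → MaskFor y₁ w₁ σ₁ x₁ → Ξ σ₁' ≡ Ξ σ₁ →
             x₁ ++ selΞ [ d' ] [ c ] ≈ x₀ ∷ʳ c →
             (NoCondRightOf (w₁ ++ c ∷ q) (σ₁ ++ d ∷ ones q) (length w₁) →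
               Phi (w₁ ++ c ∷ q) (σ₁ ++ d ∷ ones q) (σ₁' ++ d' ∷ ones q)) → ⊥
    finish σ₁ σ₁' d d' m₀ m₁ Ξ≡ e φ = MaskFor⇒RelMask p p' mask λ rm →
      k (_ , _ , rm , φ (NSD⇒NoCondRightOf (proj₁ m₁) (MaskFor-sel1 m₀) (MaskFor-selΞ m₀) n) , MaskFor-selΞ mask , v'≈)
      where
      mask : MaskFor y (w₁ ++ c ∷ q) (σ₁ ++ d ∷ ones q) u
      mask = subst₂ (λ w σ → MaskFor y w σ u) (∷ʳ-++ w₁ c q) (∷ʳ-++ σ₁ d (ones q))
        (MaskFor-resp (≈sym y≈) (≈sym u≈) (MaskFor-ones q y₀≼ n m₀))
      l' : length σ₁' ≡ length w₁
      l' = trans (sym (length-Ξ σ₁')) (trans (cong length Ξ≡) (trans (length-Ξ σ₁) (proj₁ m₁)))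
      v'≈ : selΞ (σ₁' ++ d' ∷ ones q) (w₁ ++ c ∷ q) ≈ v
      v'≈ = begin
        selΞ (σ₁' ++ d' ∷ ones q) (w₁ ++ c ∷ q)          ≡⟨ selΞ-++ σ₁' w₁ l' ⟩
        selΞ σ₁' w₁ ++ selΞ (d' ∷ ones q) (c ∷ q)        ≡⟨ cong₂ _++_ (cong (λ β → selB β w₁) Ξ≡) (selΞ-head d') ⟩
        selΞ σ₁ w₁ ++ selΞ [ d' ] [ c ] ++ q             ≡⟨ ++-assoc (selΞ σ₁ w₁) _ q ⟨
        (selΞ σ₁ w₁ ++ selΞ [ d' ] [ c ]) ++ q           ≈⟨ ++-congʳ q (≈trans (++-congʳ _ (MaskFor-selΞ m₁)) e) ⟩
        (x₀ ∷ʳ c) ++ q                                   ≈⟨ ≈sym v≈ ⟩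
        v                                                ∎
        where open ≈-R

  -- From paths in the Hasse diagram to walks

  Covers⇒Cov : ∀ {u v} → Covers u v → Cov u v
  Covers⇒Cov ((v≤u , v≉u) , h) = ≤B⇒≼ v≤u , v≉u , λ z a b c k →
    ≼⇒≤B a λ a' → ≼⇒≤B c λ c' → h z (a' , b) (c' , k)

  matching⇒matched : ∀ {y w 𝐰 u v} → ReducedExpr 𝐰 w → InInterval y w u → InInterval y w v →
                     Matching y 𝐰 u v → ¬ ¬ Matched y 𝐰 u v
  matching⇒matched (red , e) (p , p') _ (inj₁ t) k =
    Toggle⇒MPair red (≤B⇒≼ p) (≼-resp ≈refl (≈sym e) (≤B⇒≼ p')) t λ mp → k (inj₁ mp)
  matching⇒matched (red , e) _ (p , p') (inj₂ t) k =
    Toggle⇒MPair red (≤B⇒≼ p) (≼-resp ≈refl (≈sym e) (≤B⇒≼ p')) t λ mp → k (inj₂ mp)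

  -- Both directions of the translation enter: `MPair⇒Toggle` for reversed arrows, and
  -- `Toggle⇒MPair` to keep unmatched arrows unmatched. For the latter a double negation suffices,
  -- since the claim is negative.
  arrow⇒edge : ∀ {y w 𝐰 u v} → ReducedExpr 𝐰 w → Arrow y w 𝐰 u v → Edge y 𝐰 u v
  arrow⇒edge 𝐰≈w (iu , iv , inj₁ (c , ¬mp)) = edge (≤B⇒≼ (proj₁ iu)) (≤B⇒≼ (proj₁ iv))
    (inj₁ (Covers⇒Cov c , λ mp → matching⇒matched 𝐰≈w iu iv mp ¬mp))
  arrow⇒edge 𝐰≈w (iu , iv , inj₂ (c , mp)) = edge (≤B⇒≼ (proj₁ iu)) (≤B⇒≼ (proj₁ iv))
    (inj₂ (Covers⇒Cov c , Sum.map MPair⇒Toggle MPair⇒Toggle mp))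

  path⇒walk : ∀ {y w 𝐰 u v} → ReducedExpr 𝐰 w → Path y w 𝐰 u v → Walk y 𝐰 u v
  path⇒walk 𝐰≈w (single a) = single (arrow⇒edge 𝐰≈w a)
  path⇒walk 𝐰≈w (a ∷ as)   = arrow⇒edge 𝐰≈w a ∷ path⇒walk 𝐰≈w as

theorem3p2 : (M : CoxeterMatrix) → let open Coxeter M in
    (y w 𝐰 : Word) → ReducedExpr 𝐰 w → y <B w →
    ∀ u v → Path y w 𝐰 u v → ¬ (u ≈ v)
theorem3p2 M y w 𝐰 𝐰≈w _ u v path =
  acyclic (reverseView 𝐰) (proj₁ 𝐰≈w) (path⇒walk 𝐰≈w path)
  where open Acyclicity M
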